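{- Let $\mathbb{F}$ be a field, let $n,k,\Delta\ge 1$ and $s\ge 2$ be integers, and let $C$ be a multi-$k$-ic algebraic circuit over $\mathbb{F}$ of size $s$ computing a polynomial in $n$ variables. Then there is a multi-$k$-ic $(\Sigma\Pi)^\Delta$ circuit $C'$ over $\mathbb{F}$ computing the same polynomial whose size is at most $$s^{O\left(\Delta\cdot (nk/\log s)^{1/\Delta}\right)}.$$ (The constant hidden in $O(\cdot)$ is absolute: it does not depend on $\mathbb{F}, n, k, s, \Delta, C$.)
   Context: An algebraic circuit over a field $\mathbb{F}$ and variables $x_1,\dots,x_n$ is a directed acyclic graph whose internal vertices (gates) are labeled $+$ or $\times$ and whose leaves are labeled by variables or constants from $\mathbb{F}$; each gate computes the sum or product of the polynomials computed by its children, and the circuit computes the polynomial at its output gate. The size of a circuit is its number of edges. Fan-in is unbounded unless stated otherwise. A proof-tree rooted at a gate $u$ of a circuit is obtained by starting with $u$, including all children of every included $\times$ gate and exactly one child of every included $+$ gate, and unfolding the result into a tree. Each proof-tree computes a monomial (the product of its leaf labels); its $x_i$-degree is the number of leaves of the unfolded tree labeled $x_i$. For a gate $u$, $\mathrm{Var}(u)=(d_1,\dots,d_n)\in\mathbb{Z}_{\ge 0}^n$, where $d_i$ is the maximum $x_i$-degree over all proof-trees rooted at $u$. (Equivalently, $\mathrm{Var}(x_i)$ is the $i$-th unit vector, $\mathrm{Var}$ of a constant is $0$, $\mathrm{Var}$ of a $\times$ gate is the sum of the vectors of its children counted with multiplicity, and $\mathrm{Var}$ of a $+$ gate is the coordinate-wise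 maximum.) A circuit is multi-$k$-ic (syntactically) if $\mathrm{Var}(u)\in\{0,1,\dots,k\}^n$ for every gate $u$. A $(\Sigma\Pi)^\Delta$ circuit (circuit of product-depth $\Delta$) is a circuit with $2\Delta$ layers of alternating sum and product gates of unbounded fan-in, the top (output) layer being a sum layer; inputs of gates in a layer are gates of the next layer below or leaves. $\log$ is to base 2. -}

module Defs where

open import Algebra.Apartness.Bundles using (HeytingField; HeytingCommutativeRing)
open import Algebra.Bundles using (CommutativeRing)
import Algebra.Definitions.RawMonoid as RawMonoidDefinitions
open import Data.Bool.Base using (if_then_else_)
open import Data.Fin.Base using (Fin; zero; suc; toℕ)
import Data.Fin.Properties as Fin
open import Data.List.Base using (List; []; _∷_; foldr; map)
import Data.List.Base as List using (sum)
open import Data.List.Membership.Propositional using (_∈_)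
open import Data.List.NonEmpty.Base as List⁺ using (List⁺; _∷_; toList)
open import Data.List.Relation.Unary.All using (All; []; _∷_)
open import Data.List.Relation.Unary.Any using (here; there)
open import Data.Nat.Base
open import Data.Nat.Properties as ℕ
  using (m≤m⊔n; m≤n⊔m; ≤-trans; ≤-refl; +-mono-≤; ⊔-sel; ⊔-identityʳ)
open import Data.Product.Base using (Σ; _×_; _,_)
open import Data.Sum.Base using (_⊎_; inj₁; inj₂)
open import Data.Unit.Base using (⊤)
open import Data.Empty using (⊥)
open import Data.Vec.Base using (Vec; []; _∷_; replicate; tabulate)
open import Data.Vec.Properties using (≡-dec)
open import Level using (Level; Setω)
open import Relation.Binary.PropositionalEquality
  using (_≡_; refl; sym; trans; cong₂)
open import Relation.Nullary.Decidable using (does)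

private
  variable
    a ℓ₁ ℓ₂ : Level
    A : Set a
    n N : ℕ

-- An existential whose body may quantify over all universe levels, so that
-- the witness is chosen before them.
record ∃ω {a} (A : Set a) (P : A → Setω) : Setω where
  constructor _,_
  field
    witness : A
    holds   : P witness

------------------------------------------------------------------------
-- Circuits

data Vertex (A : Set a) (n : ℕ) (V : Set) : Set a where
  var   : Fin n → Vertex A n V
  const : A → Vertex A n V
  sum   : List⁺ V → Vertex A n V
  prod  : List⁺ V → Vertex A n V

-- A directed acyclic graph is presented along a topological order: each new
-- vertex has its children among the earlier ones.  The most recent vertex is
-- zero and suc refers to earlier ones.  Children form a list, so parallel
-- edges are possible.
infixl 5 _▷_
data Dag (A : Set a) (n : ℕ) : ℕ → Set a where
  []  : Dag A n 0
  _▷_ : Dag A n N → Vertex A n (Fin N) → Dag A n (suc N)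

record Circuit (A : Set a) (n : ℕ) : Set a where
  field
    {order} : ℕ
    dag     : Dag A n order
    output  : Fin order

open Circuit public

mapVertex : ∀ {V W : Set} → (V → W) → Vertex A n V → Vertex A n W
mapVertex f (var i)   = var i
mapVertex f (const c) = const c
mapVertex f (sum us)  = sum (List⁺.map f us)
mapVertex f (prod us) = prod (List⁺.map f us)

vertex : Dag A n N → Fin N → Vertex A n (Fin N)
vertex (C ▷ g) zero    = mapVertex suc g
vertex (C ▷ g) (suc u) = mapVertex suc (vertex C u)

fanIn : ∀ {V : Set} → Vertex A n V → ℕ
fanIn (var _)   = 0
fanIn (const _) = 0
fanIn (sum us)  = List⁺.length us
fanIn (prod us) = List⁺.length us

edges : Dag A n N → ℕ
edges []      = 0
edges (C ▷ g) = edges C + fanIn g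

size : Circuit A n → ℕ
size C = edges (dag C)

------------------------------------------------------------------------
-- Syntactic degrees

unit : Fin n → Fin n → ℕ
unit j i = if does (i Fin.≟ j) then 1 else 0

Var : Dag A n N → Fin N → Fin n → ℕ
Var (C ▷ g)       (suc u) i = Var C u i
Var (C ▷ var j)   zero    i = unit j i
Var (C ▷ const _) zero    i = 0
Var (C ▷ sum us)  zero    i = foldr _⊔_ 0 (map (λ u → Var C u i) (toList us))
Var (C ▷ prod us) zero    i = List.sum (map (λ u → Var C u i) (toList us))

MultiIc : ℕ → Circuit A n → Set
MultiIc k C = ∀ u i → Var (dag C) u i ≤ k

-- Proof-trees are defined only to show, in Var-upper and Var-attained, that
-- Var C u i is the maximum xᵢ-degree over all proof-trees rooted at u.  Distinct
-- occurrences of a sum gate may choose distinct children here; the maximum is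
-- the same if they must agree, as it is reached by a best child at each gate.

data ProofTree {A : Set a} {n : ℕ} : ∀ {N} → Dag A n N → Fin N → Set a where
  earlier : ∀ {N} {C : Dag A n N} {g u} →
            ProofTree C u → ProofTree (C ▷ g) (suc u)
  var     : ∀ {N} {C : Dag A n N} j → ProofTree (C ▷ var j) zero
  const   : ∀ {N} {C : Dag A n N} c → ProofTree (C ▷ const c) zero
  sum     : ∀ {N} {C : Dag A n N} {us u} →
            u ∈ toList us → ProofTree C u → ProofTree (C ▷ sum us) zero
  prod    : ∀ {N} {C : Dag A n N} {us} →
            All (ProofTree C) (toList us) → ProofTree (C ▷ prod us) zero

mutual
  degree : ∀ {C : Dag A n N} {u} → Fin n → ProofTree C u → ℕ
  degree i (earlier T) = degree i T
  degree i (var j)     = unit j i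
  degree i (const _)   = 0
  degree i (sum _ T)   = degree i T
  degree i (prod Ts)   = degrees i Ts

  degrees : ∀ {C : Dag A n N} {us} → Fin n → All (ProofTree C) us → ℕ
  degrees i []       = 0
  degrees i (T ∷ Ts) = degree i T + degrees i Ts

private
  ∈⇒≤max : ∀ (f : Fin N → ℕ) {u us} → u ∈ us → f u ≤ foldr _⊔_ 0 (map f us)
  ∈⇒≤max f (here refl)      = m≤m⊔n _ _
  ∈⇒≤max f (there {x} u∈us) = ≤-trans (∈⇒≤max f u∈us) (m≤n⊔m (f x) _)

  max-∈ : ∀ (f : Fin N → ℕ) u us →
          Σ (Fin N) λ v → v ∈ (u ∷ us) × f v ≡ foldr _⊔_ 0 (map f (u ∷ us))
  max-∈ f u []       = u , here refl , sym (⊔-identityʳ (f u))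
  max-∈ f u (w ∷ us) with ⊔-sel (f u) (foldr _⊔_ 0 (map f (w ∷ us)))
  ... | inj₁ eq = u , here refl , sym eq
  ... | inj₂ eq with v , v∈ , fv≡ ← max-∈ f w us = v , there v∈ , trans fv≡ (sym eq)

mutual
  Var-upper : ∀ {C : Dag A n N} {u} i (T : ProofTree C u) → degree i T ≤ Var C u i
  Var-upper i (earlier T)              = Var-upper i T
  Var-upper i (var j)                  = ≤-refl
  Var-upper i (const _)                = ≤-refl
  Var-upper i (sum {C = C} u∈us T)     =
    ≤-trans (Var-upper i T) (∈⇒≤max (λ u → Var C u i) u∈us)
  Var-upper i (prod Ts)                = Vars-upper i Ts

  Vars-upper : ∀ {C : Dag A n N} {us} i (Ts : All (ProofTree C) us) →
               degrees i Ts ≤ List.sum (map (λ u → Var C u i) us)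
  Vars-upper i []       = ≤-refl
  Vars-upper i (T ∷ Ts) = +-mono-≤ (Var-upper i T) (Vars-upper i Ts)

mutual
  Var-attained : ∀ (C : Dag A n N) u i → Σ (ProofTree C u) λ T → degree i T ≡ Var C u i
  Var-attained (C ▷ g)       (suc u) i with T , eq ← Var-attained C u i = earlier T , eq
  Var-attained (C ▷ var j)   zero    i = var j , refl
  Var-attained (C ▷ const c) zero    i = const c , refl
  Var-attained (C ▷ sum (u ∷ us)) zero i
    with v , v∈ , eq ← max-∈ (λ w → Var C w i) u us
    with T , eq′ ← Var-attained C v i = sum v∈ T , trans eq′ eq
  Var-attained (C ▷ prod us) zero i
    with Ts , eq ← Vars-attained C (toList us) i = prod Ts , eq

  Vars-attained : ∀ (C : Dag A n N) us i → Σ (All (ProofTree C) us) λ Ts →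
                  degrees i Ts ≡ List.sum (map (λ u → Var C u i) us)
  Vars-attained C []       i = [] , refl
  Vars-attained C (u ∷ us) i
    with T , eq ← Var-attained C u i | Ts , eqs ← Vars-attained C us i =
    T ∷ Ts , cong₂ _+_ eq eqs

------------------------------------------------------------------------
-- Product-depth

IsLeaf : ∀ {V : Set} → Vertex A n V → Set
IsLeaf (var _)   = ⊤
IsLeaf (const _) = ⊤
IsLeaf (sum _)   = ⊥
IsLeaf (prod _)  = ⊥

IsSum : ∀ {V : Set} → Vertex A n V → Set
IsSum (sum _) = ⊤
IsSum _       = ⊥

-- Layers are numbered from the output layer 0 down to 2Δ - 1, so that the sum
-- layers are the even ones; the layer of a leaf is irrelevant.
module _ (Δ : ℕ) (C : Dag A n N) (layer : Fin N → ℕ) where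

  InputFor : ℕ → Fin N → Set
  InputFor l v = IsLeaf (vertex C v) ⊎ layer v ≡ suc l

  InLayer : ℕ → Vertex A n (Fin N) → Set
  InLayer l (var _)   = ⊤
  InLayer l (const _) = ⊤
  InLayer l (sum us)  = l < 2 * Δ × l % 2 ≡ 0 × All (InputFor l) (toList us)
  InLayer l (prod us) = l < 2 * Δ × l % 2 ≡ 1 × All (InputFor l) (toList us)

record ProductDepth (Δ : ℕ) (C : Circuit A n) : Set where
  field
    layer       : Fin (order C) → ℕ
    inLayer     : ∀ u → InLayer Δ (dag C) layer (layer u) (vertex (dag C) u)
    outputSum   : IsSum (vertex (dag C) (output C))
    outputLayer : layer (output C) ≡ 0

------------------------------------------------------------------------
-- The polynomial computed by a circuit

module _ (F : HeytingField a ℓ₁ ℓ₂) where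
  open HeytingField F
    using (Carrier; _≈_; 0#; 1#; heytingCommutativeRing)
    renaming (_+_ to _+F_; _*_ to _*F_)
  open CommutativeRing (HeytingCommutativeRing.commutativeRing heytingCommutativeRing)
    using (+-rawMonoid)
  open RawMonoidDefinitions +-rawMonoid using () renaming (sum to ∑)

  -- The coefficient of each monomial x₁^m₁ ⋯ xₙ^mₙ.  Finite support is not
  -- recorded: it holds for everything a circuit computes.
  Polynomial : ℕ → Set a
  Polynomial n = Vec ℕ n → Carrier

  infix 4 _≋_
  _≋_ : Polynomial n → Polynomial n → Set ℓ₁
  p ≋ q = ∀ m → p m ≈ q m

  term : Carrier → Vec ℕ n → Polynomial n
  term c e m = if does (≡-dec ℕ._≟_ m e) then c else 0#

  constP : Carrier → Polynomial n
  constP c = term c (replicate _ 0)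

  varP : Fin n → Polynomial n
  varP j = term 1# (tabulate (unit j))

  infixl 6 _⊕_
  _⊕_ : Polynomial n → Polynomial n → Polynomial n
  (p ⊕ q) m = p m +F q m

  -- The coefficient of m in the product is the sum of p d * q (m - d) over all
  -- d ≤ m (coordinate-wise), taken one coordinate at a time.
  infixl 7 _⊗_
  _⊗_ : Polynomial n → Polynomial n → Polynomial n
  (p ⊗ q) []      = p [] *F q []
  (p ⊗ q) (d ∷ m) =
    ∑ {suc d} λ i → ((λ m′ → p (toℕ i ∷ m′)) ⊗ (λ m′ → q (d ∸ toℕ i ∷ m′))) m

  polynomialAt : Dag Carrier n N → Fin N → Polynomial n
  polynomialAt (C ▷ g)       (suc u) = polynomialAt C u
  polynomialAt (C ▷ var j)   zero    = varP j
  polynomialAt (C ▷ const c) zero    = constP c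
  polynomialAt (C ▷ sum us)  zero    = foldr _⊕_ (constP 0#) (map (polynomialAt C) (toList us))
  polynomialAt (C ▷ prod us) zero    = foldr _⊗_ (constP 1#) (map (polynomialAt C) (toList us))

  polynomial : Circuit Carrier n → Polynomial n
  polynomial C = polynomialAt (dag C) (output C)

------------------------------------------------------------------------
-- Powers with real exponent

-- For s ≥ 1 and a real number E ≥ 0, given by the relation p / q ≥ E on
-- naturals p and q ≥ 1, this is exactly m ≤ s^E, since m ≤ s^E holds iff
-- m ≤ s^(p/q) for all rationals p / q ≥ E.
infix 4 _≤_^[_]
_≤_^[_] : ℕ → ℕ → (ℕ → ℕ → Set) → Set
m ≤ s ^[ _/_≥E ] = ∀ p q → 1 ≤ q → p / q ≥E → m ^ q ≤ s ^ p

-- The relation p / q ≥ c Δ (nk / log₂ s)^(1/Δ) for s ≥ 2 and Δ ≥ 1, in the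
-- equivalent form (c Δ q)^Δ n k ≤ p^Δ log₂ s with both sides exponentiated.
exponent : (c Δ n k s : ℕ) → ℕ → ℕ → Set
exponent c Δ n k s p q = 2 ^ ((c * Δ * q) ^ Δ * (n * k)) ≤ s ^ (p ^ Δ)

{-# OPTIONS --safe #-}
module Submission where

-- The weight of a gate u is the sum of the entries of Var u; it is additive at
-- products and at most nk.  Write [u : v] for the sum over all paths from u to
-- v, always into the heavier factor of a product, of the products of the lighter
-- factors met.  Cutting heavy paths at the arc where the weight drops to t gives
--   f_u     = Σ [u : w] f_c f_h          and
--   [u : v] = Σ [u : w] f_c [h : v]      (weights relative to that of v),
-- with w of weight more than t.  Iterated O(d/t) times on an item of weight d,
-- this is a sum of s^O(d/t) products of O(d/t) items of weight at most t whose
-- degree vectors add up to at most that of the item, so multi-k-icity is kept.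
-- With ℓ ≈ log s and R ≈ (nk/ℓ)^(1/Δ), lower the weight from R^Δ ℓ ≥ nk by a
-- factor R in each ΣΠ layer, and write the items of weight at most R ℓ as sums of
-- at most 2^(R ℓ) monomials.  If nk ≤ ℓ, all of f is a sum of 2^nk monomials.

open import Algebra.Apartness.Bundles using (HeytingField; HeytingCommutativeRing)
open import Algebra.Bundles using (CommutativeRing; CommutativeSemiring)
import Algebra.Properties.CommutativeSemigroup as CommutativeSemigroupProperties
open import Algebra.Structures.Biased using (isCommutativeMonoidˡ; isCommutativeSemiringˡ)
open import Data.Bool.Base using (true; false; if_then_else_; _∧_)
open import Data.Fin.Base using (Fin; zero; suc)
import Data.Fin.Properties as Fin
open import Data.List.Base as List
  using (List; []; _∷_; foldr; map; _++_; filter; length; upTo; cartesianProductWith)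
open import Data.List.Membership.Propositional using (_∈_; _∉_)
import Data.List.Membership.Propositional.Properties as ∈
open import Data.List.NonEmpty.Base as List⁺ using (_∷_)
import Data.List.Properties as List
open import Data.List.Relation.Binary.Pointwise.Base using (Pointwise; []; _∷_)
open import Data.List.Relation.Unary.All as All using (All; []; _∷_)
import Data.List.Relation.Unary.All.Properties as All
open import Data.List.Relation.Unary.Any using (here; there)
open import Data.List.Relation.Unary.Unique.Propositional using (Unique; []; _∷_)
import Data.List.Relation.Unary.Unique.Propositional.Properties as Unique
open import Data.Maybe.Base using (Maybe; just; nothing)
open import Data.Nat.Base as ℕ
  using (ℕ; zero; suc; _≤_; _<_; _∸_; _⊔_; z≤n; s≤s; z<s; >-nonZero)
open import Data.Nat.DivMod using (m≡m%n+[m/n]*n; m%n<n; m/n*n≤m)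
open import Data.Nat.Induction using (<-rec)
open import Data.Nat.ListAction using () renaming (sum to sumℕ)
open import Data.Nat.ListAction.Properties using (sum-++)
import Data.Nat.Properties as ℕ
open import Data.Nat.Solver using (module +-*-Solver)
open import Data.Product.Base using (Σ; _×_; _,_; proj₁; proj₂)
open import Data.Sum.Base using (_⊎_; inj₁; inj₂)
open import Data.Unit.Base using (tt)
open import Data.Vec.Base using (Vec; []; _∷_; replicate; lookup; tabulate; zipWith)
import Data.Vec.Properties as Vec
open import Function.Base using (_∘_)
open import Level using (Level)
open import Relation.Binary.PropositionalEquality as ≡ using (_≡_; _≢_)
import Relation.Binary.Reasoning.Setoid as SetoidReasoning
open import Relation.Binary.Structures using (IsEquivalence)
open import Relation.Nullary.Decidable using (Dec; does; yes; no; _×-dec_)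
open import Relation.Nullary.Negation using (¬_; contradiction)
open import Relation.Unary using (Pred; Decidable)

open import Algebra.Properties.CommutativeMonoid.Sum ℕ.+-0-commutativeMonoid
  using (∑-distrib-+; sum-cong-≗; sum-replicate-zero) renaming (sum to total)

open import Defs hiding (_≋_; _⊕_; _⊗_; term; constP; varP; Polynomial; degree; degrees)
import Defs

-- What shapes the proof is that every factor of an expansion becomes a gate, so its syntactic
-- degrees, and not only those of its polynomial, must stay within `k`. A quotient [u : v] is
-- therefore carried along with the vector Var u - Var v. It vanishes unless Var v ≤ Var u in every
-- coordinate, and only arcs passing these comparisons are kept, so that no subtraction is
-- truncated. A cut chooses one arc and replaces one item by three. Products are made binary in such
-- a way that there are exactly as many arcs as edges, so the choice costs a factor s. After a cut,
-- [h : v] is already light and only [u : w] and f_c may need more cuts. About 2d/t cuts suffice;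
-- with t = d/R a layer has s^(2R) terms of 1 + 4R factors, so each layer multiplies the size by
-- s^O(R). A list of 2^O(R ℓ) monomials has size s^O(R) as well, which is why the descent can stop
-- at weight R ℓ with ℓ ≈ log s.

private
  variable
    a ℓ₁ ℓ₂ : Level
    n N M : ℕ

-- The semiring of polynomials and bounds on individual degrees

module Polynomials (F : HeytingField a ℓ₁ ℓ₂) where

  open CommutativeRing
    (HeytingCommutativeRing.commutativeRing (HeytingField.heytingCommutativeRing F))
    hiding (zero)
  open CommutativeSemigroupProperties +-commutativeSemigroup using (interchange)
  open SetoidReasoning setoid

  Polynomial : ℕ → Set a
  Polynomial = Defs.Polynomial F

  infix 4 _≋_
  infixl 6 _⊕_
  infixl 7 _⊗_

  _≋_ : Polynomial n → Polynomial n → Set ℓ₁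
  _≋_ = Defs._≋_ F

  _⊕_ _⊗_ : Polynomial n → Polynomial n → Polynomial n
  _⊕_ = Defs._⊕_ F
  _⊗_ = Defs._⊗_ F

  term : Carrier → Vec ℕ n → Polynomial n
  term = Defs.term F

  constP : Carrier → Polynomial n
  constP = Defs.constP F

  varP : Fin n → Polynomial n
  varP = Defs.varP F

  IsZero : Polynomial n → Set ℓ₁
  IsZero p = ∀ m → p m ≈ 0#

  slice : Polynomial (suc n) → ℕ → Polynomial n
  slice p d m = p (d ∷ m)

  shift : Polynomial (suc n) → Polynomial (suc n)
  shift p (d ∷ m) = p (suc d ∷ m)

  -- In the first variable, ⊗ is a Cauchy product over the polynomials in the
  -- other variables: (p ⊗ q) (suc d ∷ m) unfolds to
  -- (slice p 0 ⊗ slice q (suc d)) m + (shift p ⊗ q) (d ∷ m).  The laws are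
  -- proved from this recursion.
  ⊗-zero : ∀ (p q : Polynomial (suc n)) m →
           (p ⊗ q) (0 ∷ m) ≈ (slice p 0 ⊗ slice q 0) m
  ⊗-zero p q m = +-identityʳ _

  ⊗-zeroˡ : ∀ (p q : Polynomial n) → IsZero p → IsZero (p ⊗ q)
  ⊗-zeroˡ p q p≈0 []          = trans (*-congʳ (p≈0 [])) (zeroˡ _)
  ⊗-zeroˡ p q p≈0 (zero ∷ m)  =
    trans (⊗-zero p q m) (⊗-zeroˡ (slice p 0) (slice q 0) (λ m → p≈0 (0 ∷ m)) m)
  ⊗-zeroˡ p q p≈0 (suc d ∷ m) = trans
    (+-cong (⊗-zeroˡ (slice p 0) (slice q (suc d)) (λ m → p≈0 (0 ∷ m)) m)
            (⊗-zeroˡ (shift p) q (λ { (e ∷ m) → p≈0 (suc e ∷ m) }) (d ∷ m)))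
    (+-identityˡ _)

  ⊗-cong : ∀ {p p′ q q′ : Polynomial n} → p ≋ p′ → q ≋ q′ → p ⊗ q ≋ p′ ⊗ q′
  ⊗-cong p≋ q≋ []          = *-cong (p≋ []) (q≋ [])
  ⊗-cong p≋ q≋ (zero ∷ m)  =
    +-cong (⊗-cong (λ m → p≋ (0 ∷ m)) (λ m → q≋ (0 ∷ m)) m) refl
  ⊗-cong {p = p} {p′} {q} {q′} p≋ q≋ (suc d ∷ m) =
    +-cong (⊗-cong (λ m → p≋ (0 ∷ m)) (λ m → q≋ (suc d ∷ m)) m)
           (⊗-cong {p = shift p} {shift p′} {q} {q′} (λ { (e ∷ m) → p≋ (suc e ∷ m) }) q≋ (d ∷ m))

  ⊗-distribʳ : ∀ (r p q : Polynomial n) → (p ⊕ q) ⊗ r ≋ p ⊗ r ⊕ q ⊗ r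
  ⊗-distribʳ r p q []          = distribʳ _ _ _
  ⊗-distribʳ r p q (zero ∷ m)  = begin
    (((p ⊕ q) ⊗ r) (0 ∷ m))             ≈⟨ ⊗-zero (p ⊕ q) r m ⟩
    ((slice p 0 ⊕ slice q 0) ⊗ slice r 0) m ≈⟨ ⊗-distribʳ (slice r 0) (slice p 0) (slice q 0) m ⟩
    (slice p 0 ⊗ slice r 0) m + (slice q 0 ⊗ slice r 0) m ≈⟨ +-cong (⊗-zero p r m) (⊗-zero q r m) ⟨
    (p ⊗ r) (0 ∷ m) + (q ⊗ r) (0 ∷ m)   ∎
  ⊗-distribʳ r p q (suc d ∷ m) = begin
    ((slice p 0 ⊕ slice q 0) ⊗ slice r (suc d)) m + (shift (p ⊕ q) ⊗ r) (d ∷ m)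
      ≈⟨ +-cong (⊗-distribʳ (slice r (suc d)) (slice p 0) (slice q 0) m)
                (trans (⊗-cong {p = shift (p ⊕ q)} {shift p ⊕ shift q} {r}
                               (λ { (e ∷ m) → refl }) (λ _ → refl) (d ∷ m))
                       (⊗-distribʳ r (shift p) (shift q) (d ∷ m))) ⟩
    ((slice p 0 ⊗ slice r (suc d)) m + (slice q 0 ⊗ slice r (suc d)) m) +
    ((shift p ⊗ r) (d ∷ m) + (shift q ⊗ r) (d ∷ m))
      ≈⟨ interchange _ _ _ _ ⟩
    (p ⊗ r) (suc d ∷ m) + (q ⊗ r) (suc d ∷ m) ∎

  -- The recursion peels off the first summand of the Cauchy product, this the last one.
  -- Commutativity needs both, as exchanging the factors reverses the sum.
  ⊗-sucʳ : ∀ (p q : Polynomial (suc n)) d m →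
           (p ⊗ q) (suc d ∷ m) ≈ (p ⊗ shift q) (d ∷ m) + (slice p (suc d) ⊗ slice q 0) m
  ⊗-sucʳ p q zero    m = trans (sym (+-assoc _ _ _)) (trans (+-identityʳ _)
    (+-congʳ (sym (+-identityʳ _))))
  ⊗-sucʳ p q (suc d) m = trans (+-congˡ (⊗-sucʳ (shift p) q d m)) (sym (+-assoc _ _ _))

  ⊗-comm : ∀ (p q : Polynomial n) → p ⊗ q ≋ q ⊗ p
  ⊗-comm p q []          = *-comm _ _
  ⊗-comm p q (zero ∷ m)  = +-congʳ (⊗-comm (slice p 0) (slice q 0) m)
  ⊗-comm p q (suc d ∷ m) = begin
    (slice p 0 ⊗ slice q (suc d)) m + (shift p ⊗ q) (d ∷ m)
      ≈⟨ +-cong (⊗-comm (slice p 0) (slice q (suc d)) m) (⊗-comm (shift p) q (d ∷ m)) ⟩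
    (slice q (suc d) ⊗ slice p 0) m + (q ⊗ shift p) (d ∷ m) ≈⟨ +-comm _ _ ⟩
    (q ⊗ shift p) (d ∷ m) + (slice q (suc d) ⊗ slice p 0) m ≈⟨ ⊗-sucʳ q p d m ⟨
    (q ⊗ p) (suc d ∷ m) ∎

  ⊗-slice : ∀ (p q : Polynomial (suc n)) → (∀ d → IsZero (slice p (suc d))) →
            ∀ d m → (p ⊗ q) (d ∷ m) ≈ (slice p 0 ⊗ slice q d) m
  ⊗-slice p q p≈0 zero    m = ⊗-zero p q m
  ⊗-slice p q p≈0 (suc d) m = trans
    (+-congˡ (⊗-zeroˡ (shift p) q (λ { (e ∷ m) → p≈0 e m }) (d ∷ m))) (+-identityʳ _)

  private
    -- `p` as a polynomial free of the first variable. With it, `shift (p ⊗ q)` is again a sum of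
    -- products, `embed (slice p 0) ⊗ shift q ⊕ shift p ⊗ q`, to which an induction hypothesis can
    -- apply.
    embed : Polynomial n → Polynomial (suc n)
    embed p (zero  ∷ m) = p m
    embed p (suc _ ∷ m) = 0#

    embed-⊗ : ∀ (p : Polynomial n) q d m → (embed p ⊗ q) (d ∷ m) ≈ (p ⊗ slice q d) m
    embed-⊗ p q = ⊗-slice (embed p) q (λ _ _ → refl)

  ⊗-distribˡ : ∀ (r p q : Polynomial n) → r ⊗ (p ⊕ q) ≋ r ⊗ p ⊕ r ⊗ q
  ⊗-distribˡ r p q m = trans (⊗-comm r (p ⊕ q) m) (trans (⊗-distribʳ r p q m)
    (+-cong (⊗-comm p r m) (⊗-comm q r m)))

  mutual
    -- Induction on the number of variables, then on the exponent of the first. Shifting a product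
    -- creates a factor free of the first variable; `⊗-assoc-embed` is the case of such a factor.
    ⊗-assoc : ∀ (p q r : Polynomial n) → (p ⊗ q) ⊗ r ≋ p ⊗ (q ⊗ r)
    ⊗-assoc p q r []      = *-assoc _ _ _
    ⊗-assoc p q r (d ∷ m) = ⊗-assoc-∷ p q r d m

    ⊗-assoc-embed : ∀ (p : Polynomial n) q r d m →
                    ((embed p ⊗ q) ⊗ r) (d ∷ m) ≈ (p ⊗ slice (q ⊗ r) d) m
    ⊗-assoc-embed p q r zero    m = begin
      ((embed p ⊗ q) ⊗ r) (0 ∷ m)             ≈⟨ ⊗-zero (embed p ⊗ q) r m ⟩
      (slice (embed p ⊗ q) 0 ⊗ slice r 0) m   ≈⟨ ⊗-cong {q = slice r 0} (embed-⊗ p q 0) (λ _ → refl) m ⟩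
      ((p ⊗ slice q 0) ⊗ slice r 0) m         ≈⟨ ⊗-assoc p (slice q 0) (slice r 0) m ⟩
      (p ⊗ (slice q 0 ⊗ slice r 0)) m         ≈⟨ ⊗-cong {p = p} (λ _ → refl) (⊗-zero q r) m ⟨
      (p ⊗ slice (q ⊗ r) 0) m                 ∎
    ⊗-assoc-embed p q r (suc d) m = begin
      (slice (embed p ⊗ q) 0 ⊗ slice r (suc d)) m + (shift (embed p ⊗ q) ⊗ r) (d ∷ m)
        ≈⟨ +-cong (⊗-cong {q = slice r (suc d)} (embed-⊗ p q 0) (λ _ → refl) m)
                  (⊗-cong {q = r} shift-embed-⊗ (λ _ → refl) (d ∷ m)) ⟩
      ((p ⊗ slice q 0) ⊗ slice r (suc d)) m + ((embed p ⊗ shift q) ⊗ r) (d ∷ m)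
        ≈⟨ +-cong (⊗-assoc p (slice q 0) (slice r (suc d)) m) (⊗-assoc-embed p (shift q) r d m) ⟩
      (p ⊗ (slice q 0 ⊗ slice r (suc d))) m + (p ⊗ slice (shift q ⊗ r) d) m
        ≈⟨ ⊗-distribˡ p (slice q 0 ⊗ slice r (suc d)) (slice (shift q ⊗ r) d) m ⟨
      (p ⊗ slice (q ⊗ r) (suc d)) m ∎
      where
      shift-embed-⊗ : shift (embed p ⊗ q) ≋ embed p ⊗ shift q
      shift-embed-⊗ (e ∷ m) = trans (embed-⊗ p q (suc e) m) (sym (embed-⊗ p (shift q) e m))

    ⊗-assoc-∷ : ∀ (p q r : Polynomial (suc n)) d m →
                ((p ⊗ q) ⊗ r) (d ∷ m) ≈ (p ⊗ (q ⊗ r)) (d ∷ m)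
    ⊗-assoc-∷ p q r zero    m = begin
      ((p ⊗ q) ⊗ r) (0 ∷ m)                      ≈⟨ ⊗-zero (p ⊗ q) r m ⟩
      (slice (p ⊗ q) 0 ⊗ slice r 0) m            ≈⟨ ⊗-cong {q = slice r 0} (⊗-zero p q) (λ _ → refl) m ⟩
      ((slice p 0 ⊗ slice q 0) ⊗ slice r 0) m    ≈⟨ ⊗-assoc (slice p 0) (slice q 0) (slice r 0) m ⟩
      (slice p 0 ⊗ (slice q 0 ⊗ slice r 0)) m    ≈⟨ ⊗-cong {p = slice p 0} (λ _ → refl) (⊗-zero q r) m ⟨
      (slice p 0 ⊗ slice (q ⊗ r) 0) m            ≈⟨ ⊗-zero p (q ⊗ r) m ⟨
      (p ⊗ (q ⊗ r)) (0 ∷ m)                      ∎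
    ⊗-assoc-∷ p q r (suc d) m = begin
      (slice (p ⊗ q) 0 ⊗ slice r (suc d)) m + (shift (p ⊗ q) ⊗ r) (d ∷ m)
        ≈⟨ +-cong (⊗-cong {q = slice r (suc d)} (⊗-zero p q) (λ _ → refl) m)
                  (⊗-cong {q = r} shift-⊗ (λ _ → refl) (d ∷ m)) ⟩
      ((p₀ ⊗ slice q 0) ⊗ slice r (suc d)) m + ((embed p₀ ⊗ shift q ⊕ shift p ⊗ q) ⊗ r) (d ∷ m)
        ≈⟨ +-cong (⊗-assoc p₀ (slice q 0) (slice r (suc d)) m)
                  (⊗-distribʳ r (embed p₀ ⊗ shift q) (shift p ⊗ q) (d ∷ m)) ⟩
      (p₀ ⊗ (slice q 0 ⊗ slice r (suc d))) m +
      (((embed p₀ ⊗ shift q) ⊗ r) (d ∷ m) + ((shift p ⊗ q) ⊗ r) (d ∷ m))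
        ≈⟨ +-congˡ (+-cong (⊗-assoc-embed p₀ (shift q) r d m) (⊗-assoc-∷ (shift p) q r d m)) ⟩
      (p₀ ⊗ (slice q 0 ⊗ slice r (suc d))) m +
      ((p₀ ⊗ slice (shift q ⊗ r) d) m + (shift p ⊗ (q ⊗ r)) (d ∷ m))
        ≈⟨ +-assoc _ _ _ ⟨
      ((p₀ ⊗ (slice q 0 ⊗ slice r (suc d))) m + (p₀ ⊗ slice (shift q ⊗ r) d) m) +
      (shift p ⊗ (q ⊗ r)) (d ∷ m)
        ≈⟨ +-congʳ (⊗-distribˡ p₀ (slice q 0 ⊗ slice r (suc d)) (slice (shift q ⊗ r) d) m) ⟨
      (p₀ ⊗ slice (q ⊗ r) (suc d)) m + (shift p ⊗ (q ⊗ r)) (d ∷ m) ∎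
      where
      p₀ = slice p 0

      shift-⊗ : shift (p ⊗ q) ≋ embed p₀ ⊗ shift q ⊕ shift p ⊗ q
      shift-⊗ (e ∷ m) = +-congʳ (sym (embed-⊗ p₀ (shift q) e m))

  constP-0 : IsZero (constP {n} 0#)
  constP-0 m with does (Vec.≡-dec ℕ._≟_ m (replicate _ 0))
  ... | true  = refl
  ... | false = refl

  ⊗-identityˡ : ∀ (p : Polynomial n) → constP 1# ⊗ p ≋ p
  ⊗-identityˡ p []      = *-identityˡ _
  ⊗-identityˡ p (d ∷ m) =
    trans (⊗-slice (constP 1#) p (λ _ _ → refl) d m) (⊗-identityˡ (slice p d) m)

  polynomials : ℕ → CommutativeSemiring a ℓ₁
  polynomials n = record
    { Carrier               = Polynomial n
    ; _≈_                   = _≋_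
    ; _+_                   = _⊕_
    ; _*_                   = _⊗_
    ; 0#                    = constP 0#
    ; 1#                    = constP 1#
    ; isCommutativeSemiring = isCommutativeSemiringˡ record
      { +-isCommutativeMonoid = isCommutativeMonoidˡ record
        { isSemigroup = record
          { isMagma = record
            { isEquivalence = isEquivalence-≋
            ; ∙-cong        = λ p≋ q≋ m → +-cong (p≋ m) (q≋ m)
            }
          ; assoc   = λ p q r m → +-assoc _ _ _
          }
        ; identityˡ   = λ p m → trans (+-congʳ (constP-0 m)) (+-identityˡ _)
        ; comm        = λ p q m → +-comm _ _
        }
      ; *-isCommutativeMonoid = isCommutativeMonoidˡ record
        { isSemigroup = record
          { isMagma = record
            { isEquivalence = isEquivalence-≋
            ; ∙-cong        = ⊗-cong
            }
          ; assoc   = ⊗-assoc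
          }
        ; identityˡ   = ⊗-identityˡ
        ; comm        = ⊗-comm
        }
      ; distribʳ              = ⊗-distribʳ
      ; zeroˡ                 = λ p m →
          trans (⊗-zeroˡ (constP 0#) p constP-0 m) (sym (constP-0 m))
      }
    }
    where
    isEquivalence-≋ : IsEquivalence (_≋_ {n})
    isEquivalence-≋ = record
      { refl = λ _ → refl ; sym = λ p≋q m → sym (p≋q m) ; trans = λ p≋q q≋r m → trans (p≋q m) (q≋r m) }

  -- Shifting lowers the first exponent of the left factor to 0; then that factor is free of the
  -- first variable and `⊗-slice` passes to the remaining ones.
  term-⊗ : ∀ c (e : Vec ℕ n) c′ e′ → term c e ⊗ term c′ e′ ≋ term (c * c′) (zipWith ℕ._+_ e e′)
  term-⊗ c []          c′ []        []      = refl
  term-⊗ c (zero ∷ e)  c′ (a′ ∷ e′) (d ∷ m) =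
    trans (⊗-slice (term c (zero ∷ e)) (term c′ (a′ ∷ e′)) (λ _ _ → refl) d m) (slices (does (d ℕ.≟ a′)))
    where
    slices : ∀ b → (term c e ⊗ (λ m → if b ∧ does (Vec.≡-dec ℕ._≟_ m e′) then c′ else 0#)) m ≈
             (if b ∧ does (Vec.≡-dec ℕ._≟_ m (zipWith ℕ._+_ e e′)) then c * c′ else 0#)
    slices true  = term-⊗ c e c′ e′ m
    slices false = trans (⊗-comm (term c e) (λ _ → 0#) m) (⊗-zeroˡ (λ _ → 0#) (term c e) (λ _ → refl) m)
  term-⊗ c (suc k ∷ e) c′ (a′ ∷ e′) (zero ∷ m) =
    trans (⊗-zero (term c (suc k ∷ e)) q m) (⊗-zeroˡ (λ _ → 0#) (slice q 0) (λ _ → refl) m)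
    where q = term c′ (a′ ∷ e′)
  term-⊗ c (suc k ∷ e) c′ (a′ ∷ e′) (suc d ∷ m) = trans
    (+-cong (⊗-zeroˡ (λ _ → 0#) (slice q (suc d)) (λ _ → refl) m)
            (trans (⊗-cong {p = shift (term c (suc k ∷ e))} {term c (k ∷ e)} {q}
                           (λ { (_ ∷ _) → refl }) (λ _ → refl) (d ∷ m))
                   (term-⊗ c (k ∷ e) c′ (a′ ∷ e′) (d ∷ m))))
    (+-identityˡ _)
    where q = term c′ (a′ ∷ e′)

  -- A bound on the polynomial itself rather than on a circuit for it. It limits the monomials that
  -- can occur when values and quotients are written out at the bottom layer.
  Supported : (Fin n → ℕ) → Polynomial n → Set ℓ₁
  Supported x p = ∀ m i → x i < lookup m i → p m ≈ 0#

  supported-0 : ∀ (x : Fin n → ℕ) → Supported x (constP 0#)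
  supported-0 x m i _ = constP-0 m

  term-≢ : ∀ c {e m : Vec ℕ n} → m ≢ e → term c e m ≈ 0#
  term-≢ c {e} {m} m≢e with Vec.≡-dec ℕ._≟_ m e
  ... | yes m≡e = contradiction m≡e m≢e
  ... | no  _   = refl

  supported-term : ∀ c (x : Fin n → ℕ) (e : Vec ℕ n) → (∀ i → lookup e i ≤ x i) → Supported x (term c e)
  supported-term c x e e≤x m i x<m =
    term-≢ c {e} {m} λ { ≡.refl → ℕ.<⇒≱ x<m (e≤x i) }

  supported-⊕ : ∀ {x : Fin n → ℕ} {p q} → Supported x p → Supported x q → Supported x (p ⊕ q)
  supported-⊕ sp sq m i x<m = trans (+-cong (sp m i x<m) (sq m i x<m)) (+-identityˡ _)

  ⊗-degree : ∀ i a b (p q : Polynomial n) →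
             (∀ m → a < lookup m i → p m ≈ 0#) → (∀ m → b < lookup m i → q m ≈ 0#) →
             ∀ m → a ℕ.+ b < lookup m i → (p ⊗ q) m ≈ 0#
  ⊗-degree zero a b p q p≈0 q≈0 (d ∷ m) = head a d p p≈0
    where
    -- Each `shift` lowers the exponent and the degree bound of `p` together.
    head : ∀ a d p → (∀ m → a < lookup m zero → p m ≈ 0#) → a ℕ.+ b < d → (p ⊗ q) (d ∷ m) ≈ 0#
    head a       zero    p p≈0 ()
    head zero    (suc d) p p≈0 b<d = trans
      (+-cong (trans (⊗-comm (slice p 0) (slice q (suc d)) m)
                     (⊗-zeroˡ (slice q (suc d)) (slice p 0) (λ m → q≈0 (suc d ∷ m) b<d) m))
              (⊗-zeroˡ (shift p) q (λ { (e ∷ m) → p≈0 (suc e ∷ m) z<s }) (d ∷ m)))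
      (+-identityˡ _)
    head (suc a) (suc d) p p≈0 (s≤s a+b<d) = trans
      (+-cong (trans (⊗-comm (slice p 0) (slice q (suc d)) m)
                     (⊗-zeroˡ (slice q (suc d)) (slice p 0)
                              (λ m → q≈0 (suc d ∷ m) (s≤s (ℕ.≤-trans (ℕ.m≤n+m b a) (ℕ.<⇒≤ a+b<d)))) m))
              (head a d (shift p) (λ { (e ∷ m) a<e → p≈0 (suc e ∷ m) (s≤s a<e) }) a+b<d))
      (+-identityˡ _)
  ⊗-degree (suc i) a b p q p≈0 q≈0 (d ∷ m) a+b<m = tail d p p≈0
    where
    tail : ∀ d p → (∀ m → a < lookup m (suc i) → p m ≈ 0#) → (p ⊗ q) (d ∷ m) ≈ 0#
    tail zero    p p≈0 = trans (⊗-zero p q m)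
      (⊗-degree i a b (slice p 0) (slice q 0) (λ m → p≈0 (0 ∷ m)) (λ m → q≈0 (0 ∷ m)) m a+b<m)
    tail (suc d) p p≈0 = trans
      (+-cong (⊗-degree i a b (slice p 0) (slice q (suc d)) (λ m → p≈0 (0 ∷ m)) (λ m → q≈0 (suc d ∷ m)) m a+b<m)
              (tail d (shift p) (λ { (e ∷ m) → p≈0 (suc e ∷ m) })))
      (+-identityˡ _)

  supported-⊗ : ∀ {x y : Fin n → ℕ} {p q} → Supported x p → Supported y q →
                Supported (λ i → x i ℕ.+ y i) (p ⊗ q)
  supported-⊗ {x = x} {y} {p} {q} sp sq m i =
    ⊗-degree i (x i) (y i) p q (λ m → sp m i) (λ m → sq m i) m

-- Degree vectors, and finite sums in a commutative semiring

infix 4 _⊑_ _⊑?_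

_⊑_ : (Fin n → ℕ) → (Fin n → ℕ) → Set
x ⊑ y = ∀ i → x i ≤ y i

_⊑?_ : ∀ (x y : Fin n → ℕ) → Dec (x ⊑ y)
x ⊑? y = Fin.all? λ i → x i ℕ.≤? y i

total-mono : ∀ {n} {x y : Fin n → ℕ} → x ⊑ y → total x ≤ total y
total-mono {zero}  x⊑y = ℕ.≤-refl
total-mono {suc n} x⊑y = ℕ.+-mono-≤ (x⊑y zero) (total-mono (λ i → x⊑y (suc i)))

total-∸ : ∀ {x y : Fin n → ℕ} → y ⊑ x → total (λ i → x i ∸ y i) ℕ.+ total y ≡ total x
total-∸ {x = x} {y} y⊑x = ≡.trans (≡.sym (∑-distrib-+ (λ i → x i ∸ y i) y))
  (sum-cong-≗ (λ i → ℕ.m∸n+n≡m (y⊑x i)))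

maximum : ∀ {X : Set} → (X → ℕ) → List X → ℕ
maximum f xs = foldr _⊔_ 0 (map f xs)

∈⇒≤maximum : ∀ {X : Set} (f : X → ℕ) {x xs} → x ∈ xs → f x ≤ maximum f xs
∈⇒≤maximum f (here ≡.refl)      = ℕ.m≤m⊔n _ _
∈⇒≤maximum f (there {x} x∈xs) = ℕ.≤-trans (∈⇒≤maximum f x∈xs) (ℕ.m≤n⊔m (f x) _)

module ListSums (R : CommutativeSemiring a ℓ₁) where

  open CommutativeSemiring R hiding (zero)
  open CommutativeSemigroupProperties +-commutativeSemigroup using (interchange)

  private
    variable
      b p : Level
      X Y Z : Set b

  ∑ ∏ : List X → (X → Carrier) → Carrier
  ∑ xs g = foldr _+_ 0# (map g xs)
  ∏ xs g = foldr _*_ 1# (map g xs)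

  ∑-cong : ∀ {xs : List X} {g h} → (∀ {x} → x ∈ xs → g x ≈ h x) → ∑ xs g ≈ ∑ xs h
  ∑-cong {xs = []}     g≈h = refl
  ∑-cong {xs = x ∷ xs} g≈h = +-cong (g≈h (here ≡.refl)) (∑-cong (g≈h ∘ there))

  ∑-zero : ∀ {xs : List X} {g} → (∀ {x} → x ∈ xs → g x ≈ 0#) → ∑ xs g ≈ 0#
  ∑-zero {xs = []}     g≈0 = refl
  ∑-zero {xs = x ∷ xs} g≈0 = trans (+-cong (g≈0 (here ≡.refl)) (∑-zero (g≈0 ∘ there))) (+-identityˡ 0#)

  ∑-map : ∀ {f : X → Y} {g} xs → ∑ (map f xs) g ≡ ∑ xs (g ∘ f)
  ∑-map xs = ≡.cong (foldr _+_ 0#) (≡.sym (List.map-∘ xs))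

  ∑-++ : ∀ {g : X → Carrier} xs {ys} → ∑ (xs ++ ys) g ≈ ∑ xs g + ∑ ys g
  ∑-++ []       = sym (+-identityˡ _)
  ∑-++ (x ∷ xs) = trans (+-congˡ (∑-++ xs)) (sym (+-assoc _ _ _))

  ∏-++ : ∀ {g : X → Carrier} xs {ys} → ∏ (xs ++ ys) g ≈ ∏ xs g * ∏ ys g
  ∏-++ []       = sym (*-identityˡ _)
  ∏-++ (x ∷ xs) = trans (*-congˡ (∏-++ xs)) (sym (*-assoc _ _ _))

  ∑-+ : ∀ {g h : X → Carrier} xs → ∑ xs (λ x → g x + h x) ≈ ∑ xs g + ∑ xs h
  ∑-+ []       = sym (+-identityˡ 0#)
  ∑-+ (x ∷ xs) = trans (+-congˡ (∑-+ xs)) (interchange _ _ _ _)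

  *-∑ : ∀ r {g : X → Carrier} xs → r * ∑ xs g ≈ ∑ xs (λ x → r * g x)
  *-∑ r []       = zeroʳ r
  *-∑ r (x ∷ xs) = trans (distribˡ r _ _) (+-congˡ (*-∑ r xs))

  ∑-* : ∀ r {g : X → Carrier} xs → ∑ xs g * r ≈ ∑ xs (λ x → g x * r)
  ∑-* r []       = zeroˡ r
  ∑-* r (x ∷ xs) = trans (distribʳ r _ _) (+-congˡ (∑-* r xs))

  ∑-swap : ∀ {g : X → Y → Carrier} xs ys →
           ∑ xs (λ x → ∑ ys (g x)) ≈ ∑ ys (λ y → ∑ xs (λ x → g x y))
  ∑-swap []       ys = sym (∑-zero {xs = ys} (λ _ → refl))
  ∑-swap (x ∷ xs) ys = trans (+-congˡ (∑-swap xs ys)) (sym (∑-+ ys))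

  ∑-filter : ∀ {P : Pred X p} (P? : Decidable P) {g} xs →
             (∀ {x} → x ∈ xs → ¬ P x → g x ≈ 0#) → ∑ (filter P? xs) g ≈ ∑ xs g
  ∑-filter P? []       g≈0 = refl
  ∑-filter P? (x ∷ xs) g≈0 with P? x
  ... | yes _  = +-congˡ (∑-filter P? xs (g≈0 ∘ there))
  ... | no ¬px = trans (∑-filter P? xs (g≈0 ∘ there))
                       (sym (trans (+-congʳ (g≈0 (here ≡.refl) ¬px)) (+-identityˡ _)))

  ∑-cartesianProductWith :
    ∀ {f : X → Y → Z} {g h k} xs ys → (∀ x y → k (f x y) ≈ g x * h y) →
    ∑ (cartesianProductWith f xs ys) k ≈ ∑ xs g * ∑ ys h
  ∑-cartesianProductWith []       ys k≈ = sym (zeroˡ _)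
  ∑-cartesianProductWith {f = f} {g} {h} {k} (x ∷ xs) ys k≈ =
    trans (∑-++ (map (f x) ys)) (trans
      (+-cong (trans (reflexive (∑-map ys))
                     (trans (∑-cong {xs = ys} (λ {y} _ → k≈ x y)) (sym (*-∑ (g x) ys))))
              (∑-cartesianProductWith xs ys k≈))
      (sym (distribʳ _ _ _)))

-- Programs with binary products, quotients, and cuts of heavy paths

-- A gate computes the sum of c * h over its list of pairs (c , h).  A sum gate
-- thus multiplies each input by 1, and products have been made binary.
module Programs (R : CommutativeSemiring a ℓ₁)
                (Supported : (Fin n → ℕ) → CommutativeSemiring.Carrier R → Set ℓ₂) where

  open CommutativeSemiring R hiding (zero)
  open ListSums R
  open SetoidReasoning setoid

  mutual
    -- Leaves weigh at most 1, so none lies above a threshold `θ ≥ 1`, and a heavy path that starts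
    -- above it and ends in a leaf must cross it.
    data Program : ℕ → Set (a Level.⊔ ℓ₂) where
      []   : Program 0
      leaf : (P : Program N) (r : Carrier) (x : Fin n → ℕ) →
             total x ≤ 1 → Supported x r → Program (suc N)
      gate : (P : Program N) (es : List (Fin N × Fin N)) →
             All (λ (c , h) → weight P c ≤ weight P h) es → Program (suc N)

    bound : Program N → Fin N → Fin n → ℕ
    bound (leaf P _ x _ _) zero    = x
    bound (leaf P _ _ _ _) (suc u) = bound P u
    bound (gate P es _)    zero    = λ i → maximum (λ (c , h) → bound P c i ℕ.+ bound P h i) es
    bound (gate P _ _)     (suc u) = bound P u

    weight : Program N → Fin N → ℕ
    weight P u = total (bound P u)

  value : Program N → Fin N → Carrier
  value (leaf P r _ _ _) zero    = r
  value (leaf P _ _ _ _) (suc u) = value P u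
  value (gate P es _)    zero    = ∑ es (λ (c , h) → value P c * value P h)
  value (gate P _ _)     (suc u) = value P u

  -- The quotient [u : v] of Valiant, Skyum, Berkowitz and Rackoff: the sum over
  -- all paths from u to v along heavy children of the product of the light
  -- siblings.
  paths : Program N → Fin N → Fin N → Carrier
  paths (leaf P _ _ _ _) zero    zero    = 1#
  paths (leaf P _ _ _ _) zero    (suc v) = 0#
  paths (leaf P _ _ _ _) (suc u) zero    = 0#
  paths (leaf P _ _ _ _) (suc u) (suc v) = paths P u v
  paths (gate P es _)    zero    zero    = 1#
  paths (gate P es _)    zero    (suc v) = ∑ es (λ (c , h) → value P c * paths P h v)
  paths (gate P _ _)     (suc u) zero    = 0#
  paths (gate P _ _)     (suc u) (suc v) = paths P u v

  -- `(w , c , h)` is the edge from the gate `w` to its heavy factor `h`, with the light factor `c`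
  -- that a path along it picks up.
  Arc : ℕ → Set
  Arc N = Fin N × Fin N × Fin N

  later : Arc N → Arc (suc N)
  later (w , c , h) = suc w , suc c , suc h

  first : Fin N × Fin N → Arc (suc N)
  first (c , h) = zero , suc c , suc h

  arcs : Program N → List (Arc N)
  arcs []               = []
  arcs (leaf P _ _ _ _) = map later (arcs P)
  arcs (gate P es _)    = map first es ++ map later (arcs P)

  arc-bound : ∀ (P : Program N) → All (λ (w , c , h) → (∀ i → bound P c i ℕ.+ bound P h i ≤ bound P w i) ×
                                                       weight P c ≤ weight P h) (arcs P)
  arc-bound []               = []
  arc-bound (leaf P _ _ _ _) = All.map⁺ (arc-bound P)
  arc-bound (gate P es ord)  = All.++⁺
    (All.map⁺ (All.tabulate λ e∈es →
      (λ i → ∈⇒≤maximum (λ (c , h) → bound P c i ℕ.+ bound P h i) e∈es) , All.lookup ord e∈es))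
    (All.map⁺ (arc-bound P))

  heavy⊑gate : ∀ (P : Program N) {es ord c h} → (c , h) ∈ es → bound P h ⊑ bound (gate P es ord) zero
  heavy⊑gate P {c = c} e∈es i =
    ℕ.≤-trans (ℕ.m≤n+m _ (bound P c i)) (∈⇒≤maximum (λ (c , h) → bound P c i ℕ.+ bound P h i) e∈es)

  -- Bounds only decrease from a gate to a heavy child, so a path to `v` can start only where the
  -- bound dominates that of `v`.
  paths-≈0 : ∀ (P : Program N) u v → ¬ bound P v ⊑ bound P u → paths P u v ≈ 0#
  paths-≈0 (leaf P _ _ _ _) zero    zero    ⋢ = contradiction (λ _ → ℕ.≤-refl) ⋢
  paths-≈0 (leaf P _ _ _ _) zero    (suc v) ⋢ = refl
  paths-≈0 (leaf P _ _ _ _) (suc u) zero    ⋢ = refl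
  paths-≈0 (leaf P _ _ _ _) (suc u) (suc v) ⋢ = paths-≈0 P u v ⋢
  paths-≈0 (gate P es _)    zero    zero    ⋢ = contradiction (λ _ → ℕ.≤-refl) ⋢
  paths-≈0 (gate P es ord)  zero    (suc v) ⋢ = ∑-zero {xs = es} λ {(c , h)} e∈es →
    trans (*-congˡ (paths-≈0 P h v λ v⊑h → ⋢ λ i →
             ℕ.≤-trans (v⊑h i) (heavy⊑gate P {es} {ord} e∈es i)))
          (zeroʳ _)
  paths-≈0 (gate P _ _)     (suc u) zero    ⋢ = refl
  paths-≈0 (gate P _ _)     (suc u) (suc v) ⋢ = paths-≈0 P u v ⋢

  -- φ satisfies the equations of all gates of weight more than θ, as a linear
  -- function of the values at heavy children.
  data Linear (θ : ℕ) : (P : Program N) → (Fin N → Carrier) → Set (a Level.⊔ ℓ₁ Level.⊔ ℓ₂) where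
    []   : ∀ {φ} → Linear θ [] φ
    leaf : ∀ {P : Program N} {r x ≤1 s φ} → Linear θ P (φ ∘ suc) → Linear θ (leaf P r x ≤1 s) φ
    gate : ∀ {P : Program N} {es ord φ} → Linear θ P (φ ∘ suc) →
           (θ < weight (gate P es ord) zero → φ zero ≈ ∑ es (λ (c , h) → value P c * φ (suc h))) →
           Linear θ (gate P es ord) φ

  linear-0 : ∀ {θ} (P : Program N) → Linear θ P (λ _ → 0#)
  linear-0 []               = []
  linear-0 (leaf P _ _ _ _) = leaf (linear-0 P)
  linear-0 (gate P es _)    = gate (linear-0 P) λ _ → sym (∑-zero {xs = es} λ _ → zeroʳ _)

  linear-value : ∀ {θ} (P : Program N) → Linear θ P (value P)
  linear-value []               = []
  linear-value (leaf P _ _ _ _) = leaf (linear-value P)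
  linear-value (gate P es _)    = gate (linear-value P) λ _ → refl

  -- The quotients with target `v` can break the equation of no gate but `v` itself, where the
  -- quotient is set to 1. The weight hypothesis exempts `v`.
  linear-paths : ∀ {θ} (P : Program N) v → weight P v ≤ θ → Linear θ P (λ u → paths P u v)
  linear-paths (leaf P _ _ _ _) zero    v≤θ = leaf (linear-0 P)
  linear-paths (leaf P _ _ _ _) (suc v) v≤θ = leaf (linear-paths P v v≤θ)
  linear-paths (gate P es _)    zero    v≤θ = gate (linear-0 P) (λ θ<v → contradiction v≤θ (ℕ.<⇒≱ θ<v))
  linear-paths (gate P es _)    (suc v) v≤θ = gate (linear-paths P v v≤θ) (λ _ → refl)

  when : ∀ {A : Set} → Dec A → Carrier → Carrier
  when (yes _) r = r
  when (no _)  r = 0#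

  Crossing : Program N → ℕ → Arc N → Set
  Crossing P θ (w , _ , h) = θ < weight P w × weight P h ≤ θ

  crossing? : ∀ (P : Program N) θ → Decidable (Crossing P θ)
  crossing? P θ (w , _ , h) = θ ℕ.<? weight P w ×-dec weight P h ℕ.≤? θ

  private
    module _ (θ : ℕ) (1≤θ : 1 ≤ θ) where

      cut : Program N → (Fin N → Carrier) → Fin N → Carrier
      cut P φ u = ∑ (arcs P) λ e@(w , c , h) →
        paths P u w * when (crossing? P θ e) (value P c * φ h)

      -- One identity serves values and quotients, both being `Linear`. At a gate above `θ`, a heavy
      -- child of weight at most `θ` contributes through its own arc, which crosses now; a heavier
      -- one contributes through the induction hypothesis. Each summand is thus counted once, and
      -- stating that the cut is 0 at light vertices keeps the first kind from being counted twice.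
      cut≈ : ∀ (P : Program N) φ → Linear θ P φ → ∀ u → cut P φ u ≈ when (θ ℕ.<? weight P u) (φ u)
      cut≈ (leaf P r x x≤1 s) φ (leaf lin) zero
        with θ ℕ.<? total x
      ... | yes θ<x = contradiction (ℕ.≤-trans x≤1 1≤θ) (ℕ.<⇒≱ θ<x)
      ... | no  _   = trans (reflexive (∑-map (arcs P))) (∑-zero {xs = arcs P} (λ _ → zeroˡ _))
      cut≈ (leaf P r x x≤1 s) φ (leaf lin) (suc u) =
        trans (reflexive (∑-map (arcs P))) (cut≈ P (φ ∘ suc) lin u)
      cut≈ (gate P es ord) φ (gate lin _) (suc u) = trans (∑-++ (map first es)) (trans
        (+-cong (trans (reflexive (∑-map es)) (∑-zero {xs = es} λ _ → zeroˡ _))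
                (trans (reflexive (∑-map (arcs P))) (cut≈ P (φ ∘ suc) lin u)))
        (+-identityˡ _))
      cut≈ (gate P es ord) φ (gate lin eq) zero = begin
        cut G φ zero
          ≈⟨ ∑-++ (map first es) ⟩
        ∑ (map first es) (λ e@(w , c , h) → paths G zero w * when (crossing? G θ e) (value G c * φ h)) +
        ∑ (map later (arcs P)) (λ e@(w , c , h) → paths G zero w * when (crossing? G θ e) (value G c * φ h))
          ≈⟨ +-cong (reflexive (∑-map es)) (reflexive (∑-map (arcs P))) ⟩
        ∑ es (λ (c , h) → 1# * now (c , h)) +
        ∑ (arcs P) (λ e@(w , c , h) → ∑ es (λ (c , h) → value P c * paths P h w) * crossed e)
          ≈⟨ +-cong (∑-cong {xs = es} λ _ → *-identityˡ _)
                    (∑-cong {xs = arcs P} λ {e} _ → trans (∑-* (crossed e) es)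
                      (∑-cong {xs = es} λ _ → *-assoc _ _ _)) ⟩
        ∑ es now +
        ∑ (arcs P) (λ e@(w , _) → ∑ es (λ (c , h) → value P c * (paths P h w * crossed e)))
          -- Exchanging the sums collects, for each heavy child `h`, the cut taken from `h`.
          ≈⟨ +-congˡ (trans (∑-swap (arcs P) es)
                            (∑-cong {xs = es} λ _ → sym (*-∑ _ (arcs P)))) ⟩
        ∑ es now + ∑ es (λ (c , h) → value P c * cut P (φ ∘ suc) h)
          ≈⟨ ∑-+ es ⟨
        ∑ es (λ (c , h) → now (c , h) + value P c * cut P (φ ∘ suc) h)
          ≈⟨ ∑-cong {xs = es} (λ {(c , h)} _ → +-congˡ (*-congˡ (cut≈ P (φ ∘ suc) lin h))) ⟩
        ∑ es (λ (c , h) → now (c , h) + value P c * when (θ ℕ.<? weight P h) (φ (suc h)))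
          ≈⟨ cases ⟩
        when (θ ℕ.<? weight G zero) (φ zero) ∎
        where
        G = gate P es ord

        now : Fin _ × Fin _ → Carrier
        now (c , h) = when (crossing? G θ (zero , suc c , suc h)) (value P c * φ (suc h))

        crossed : Arc _ → Carrier
        crossed e@(w , c , h) = when (crossing? P θ e) (value P c * φ (suc h))

        cases : ∑ es (λ (c , h) → now (c , h) + value P c * when (θ ℕ.<? weight P h) (φ (suc h))) ≈
                when (θ ℕ.<? weight G zero) (φ zero)
        cases with θ ℕ.<? weight G zero
        ... | yes θ<G = trans (∑-cong {xs = es} λ {(c , h)} _ → each c h) (sym (eq θ<G))
          where
          each : ∀ c h → when (yes θ<G ×-dec weight P h ℕ.≤? θ) (value P c * φ (suc h)) +
                         value P c * when (θ ℕ.<? weight P h) (φ (suc h)) ≈ value P c * φ (suc h)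
          each c h with weight P h ℕ.≤? θ | θ ℕ.<? weight P h
          ... | yes h≤θ | yes θ<h = contradiction h≤θ (ℕ.<⇒≱ θ<h)
          ... | yes h≤θ | no _    = trans (+-congˡ (zeroʳ _)) (+-identityʳ _)
          ... | no  h≰θ | yes _   = +-identityˡ _
          ... | no  h≰θ | no θ≮h  = contradiction (ℕ.≰⇒> h≰θ) θ≮h
        ... | no  θ≮G = ∑-zero {xs = es} λ {(c , h)} e∈es → each c h (total-mono (heavy⊑gate P {es} {ord} e∈es))
          where
          each : ∀ c h → weight P h ≤ weight G zero →
                 when (no θ≮G ×-dec weight P h ℕ.≤? θ) (value P c * φ (suc h)) +
                 value P c * when (θ ℕ.<? weight P h) (φ (suc h)) ≈ 0#
          each c h h≤G with θ ℕ.<? weight P h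
          ... | yes θ<h = contradiction (ℕ.<-≤-trans θ<h h≤G) θ≮G
          ... | no  _   = trans (+-identityˡ _) (zeroʳ _)

  -- nothing stands for the absence of a target: valueTo is then all of value P u.
  valueTo : Program N → Fin N → Maybe (Fin N) → Carrier
  valueTo P u nothing  = value P u
  valueTo P u (just v) = paths P u v

  boundOf : Program N → Maybe (Fin N) → Fin n → ℕ
  boundOf P nothing  i = 0
  boundOf P (just v) i = bound P v i

  weightOf : Program N → Maybe (Fin N) → ℕ
  weightOf P o = total (boundOf P o)

  valueTo-≈0 : ∀ (P : Program N) u o → ¬ boundOf P o ⊑ bound P u → valueTo P u o ≈ 0#
  valueTo-≈0 P u nothing  ⋢ = contradiction (λ _ → ℕ.z≤n) ⋢
  valueTo-≈0 P u (just v) ⋢ = paths-≈0 P u v ⋢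

  linear-valueTo : ∀ {θ} (P : Program N) o → weightOf P o ≤ θ → Linear θ P (λ u → valueTo P u o)
  linear-valueTo P nothing  _   = linear-value P
  linear-valueTo P (just v) v≤θ = linear-paths P v v≤θ

  -- The arcs on which the heavy path from u towards o leaves the vertices of
  -- weight more than θ.
  Cut : (P : Program N) → ℕ → Fin N → Maybe (Fin N) → Arc N → Set
  Cut P θ u o e@(w , c , h) = Crossing P θ e × bound P w ⊑ bound P u × boundOf P o ⊑ bound P h

  cut? : ∀ (P : Program N) θ u o → Decidable (Cut P θ u o)
  cut? P θ u o e@(w , c , h) =
    crossing? P θ e ×-dec (bound P w ⊑? bound P u ×-dec boundOf P o ⊑? bound P h)

  -- The arcs filtered out contribute 0: they do not cross, or one of their quotients vanishes. For
  -- those kept, no difference of bounds is truncated, on which `combine` relies.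
  valueTo-cut : ∀ (P : Program N) θ u o → 1 ≤ θ → weightOf P o ≤ θ → θ < weight P u →
                valueTo P u o ≈ ∑ (filter (cut? P θ u o) (arcs P)) λ (w , c , h) →
                                  paths P u w * (value P c * valueTo P h o)
  valueTo-cut {N = N} P θ u o 1≤θ o≤θ θ<u = begin
    φ u                                ≈⟨ when-yes ⟨
    when (θ ℕ.<? weight P u) (φ u)     ≈⟨ cut≈ θ 1≤θ P φ (linear-valueTo P o o≤θ) u ⟨
    cut θ 1≤θ P φ u                    ≈⟨ ∑-filter (cut? P θ u o) (arcs P) (λ {e} _ → dropped e) ⟨
    ∑ (filter (cut? P θ u o) (arcs P)) (λ e@(w , c , h) →
      paths P u w * when (crossing? P θ e) (value P c * φ h))
      ≈⟨ ∑-cong (λ {e} e∈ → kept e (proj₁ (proj₂ (∈.∈-filter⁻ (cut? P θ u o) {xs = arcs P} e∈)))) ⟩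
    ∑ (filter (cut? P θ u o) (arcs P)) (λ (w , c , h) → paths P u w * (value P c * φ h)) ∎
    where
    φ : Fin N → Carrier
    φ u = valueTo P u o

    when-yes : when (θ ℕ.<? weight P u) (φ u) ≈ φ u
    when-yes with θ ℕ.<? weight P u
    ... | yes _   = refl
    ... | no  θ≮u = contradiction θ<u θ≮u

    kept : ∀ ((w , c , h) : Arc N) → Crossing P θ (w , c , h) →
           paths P u w * when (crossing? P θ (w , c , h)) (value P c * φ h) ≈ paths P u w * (value P c * φ h)
    kept e crossing with crossing? P θ e
    ... | yes _ = refl
    ... | no ¬c = contradiction crossing ¬c

    dropped : ∀ ((w , c , h) : Arc N) → ¬ Cut P θ u o (w , c , h) →
              paths P u w * when (crossing? P θ (w , c , h)) (value P c * φ h) ≈ 0#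
    dropped e@(w , c , h) ¬cut with crossing? P θ e | bound P w ⊑? bound P u | boundOf P o ⊑? bound P h
    ... | no  _  | _     | _     = zeroʳ _
    ... | yes _  | no ⋢  | _     = trans (*-congʳ (paths-≈0 P u w ⋢)) (zeroˡ _)
    ... | yes _  | yes _ | no ⋢  =
      trans (*-congˡ (trans (*-congˡ (valueTo-≈0 P h o ⋢)) (zeroʳ _))) (zeroʳ _)
    ... | yes x  | yes y | yes z = contradiction (x , y , z) ¬cut

-- Expansion into sums of products of light items

length-cartesianProductWith : ∀ {b c d} {X : Set b} {Y : Set c} {Z : Set d} (f : X → Y → Z) xs ys →
  length (cartesianProductWith f xs ys) ≡ length xs ℕ.* length ys
length-cartesianProductWith f []       ys = ≡.refl
length-cartesianProductWith f (x ∷ xs) ys = ≡.trans (List.length-++ (map (f x) ys))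
  (≡.cong₂ ℕ._+_ (List.length-map _ ys) (length-cartesianProductWith f xs ys))

module SumsOfProducts (R : CommutativeSemiring a ℓ₁) {n b} {Atom : Set b}
                      (⟦_⟧ : Atom → CommutativeSemiring.Carrier R)
                      (degree : Atom → Fin n → ℕ) (size : Atom → ℕ) where

  open CommutativeSemiring R hiding (zero)
  open ListSums R

  totalDegree : List Atom → Fin n → ℕ
  totalDegree as i = sumℕ (map (λ a → degree a i) as)

  -- `T` bounds the number of terms, `L` the factors of a term, `Y` the size of a factor. The last
  -- bound is strict so that `Y` also pays for the edge leading to the factor.
  record SumOfProducts (x : Fin n → ℕ) (p : Carrier) (T L Y : ℕ) : Set (ℓ₁ Level.⊔ b) where
    field
      terms   : List (List Atom)
      correct : ∑ terms (λ as → ∏ as ⟦_⟧) ≈ p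
      bounded : All (λ as → totalDegree as ⊑ x × length as ≤ L × All (λ a → size a < Y) as) terms
      few     : length terms ≤ T

  open SumOfProducts public

  private
    variable
      x y : Fin n → ℕ
      p q : Carrier
      T T′ L L′ Y : ℕ

  weaken : x ⊑ y → p ≈ q → T ≤ T′ → L ≤ L′ → SumOfProducts x p T L Y → SumOfProducts y q T′ L′ Y
  weaken x⊑y p≈q T≤ L≤ s = record
    { terms   = terms s
    ; correct = trans (correct s) p≈q
    ; bounded = All.map (λ (d , l , z) → (λ i → ℕ.≤-trans (d i) (x⊑y i)) , ℕ.≤-trans l L≤ , z) (bounded s)
    ; few     = ℕ.≤-trans (few s) T≤
    }

  atom : ∀ a → degree a ⊑ x → size a < Y → ⟦ a ⟧ ≈ p → SumOfProducts x p 1 1 Y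
  atom a a⊑x a<Y a≈p = record
    { terms   = (a ∷ []) ∷ []
    ; correct = trans (+-identityʳ _) (trans (*-identityʳ _) a≈p)
    ; bounded = ((λ i → ℕ.≤-trans (ℕ.≤-reflexive (ℕ.+-identityʳ _)) (a⊑x i)) , ℕ.≤-refl , a<Y ∷ []) ∷ []
    ; few     = ℕ.≤-refl
    }

  infixl 7 _·_

  _·_ : SumOfProducts x p T L Y → SumOfProducts y q T′ L′ Y →
        SumOfProducts (λ i → x i ℕ.+ y i) (p * q) (T ℕ.* T′) (L ℕ.+ L′) Y
  s · t = record
    { terms   = cartesianProductWith _++_ (terms s) (terms t)
    ; correct = trans (∑-cartesianProductWith (terms s) (terms t) (λ as bs → ∏-++ as))
                      (*-cong (correct s) (correct t))
    ; bounded = All.cartesianProductWith⁺ (≡.setoid _) (≡.setoid _) _++_ (terms s) (terms t)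
        λ {as} {bs} as∈ bs∈ → let (d , l , z) = All.lookup (bounded s) as∈
                                  (d′ , l′ , z′) = All.lookup (bounded t) bs∈ in
          (λ i → ℕ.≤-trans (ℕ.≤-reflexive (totalDegree-++ as bs i)) (ℕ.+-mono-≤ (d i) (d′ i))) ,
          ℕ.≤-trans (ℕ.≤-reflexive (List.length-++ as)) (ℕ.+-mono-≤ l l′) ,
          All.++⁺ z z′
    ; few     = ℕ.≤-trans (ℕ.≤-reflexive (length-cartesianProductWith _++_ (terms s) (terms t)))
                          (ℕ.*-mono-≤ (few s) (few t))
    }
    where
    totalDegree-++ : ∀ as bs i → totalDegree (as ++ bs) i ≡ totalDegree as i ℕ.+ totalDegree bs i
    totalDegree-++ as bs i = ≡.trans (≡.cong sumℕ (List.map-++ _ as bs)) (sum-++ (map _ as) _)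

  sums : ∀ {X : Set} (zs : List X) {g : X → Carrier} →
         (∀ {z} → z ∈ zs → SumOfProducts x (g z) T L Y) →
         SumOfProducts x (∑ zs g) (length zs ℕ.* T) L Y
  sums []       s = record { terms = [] ; correct = refl ; bounded = [] ; few = z≤n }
  sums (z ∷ zs) s = record
    { terms   = terms s₀ ++ terms s₁
    ; correct = trans (∑-++ (terms s₀)) (+-cong (correct s₀) (correct s₁))
    ; bounded = All.++⁺ (bounded s₀) (bounded s₁)
    ; few     = ℕ.≤-trans (ℕ.≤-reflexive (List.length-++ (terms s₀))) (ℕ.+-mono-≤ (few s₀) (few s₁))
    }
    where
    s₀ = s (here ≡.refl)
    s₁ = sums zs (s ∘ there)

module Expansion
  (R : CommutativeSemiring a ℓ₁)
  {n : ℕ} (Supported : (Fin n → ℕ) → CommutativeSemiring.Carrier R → Set ℓ₂)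
  {b} {Atom : Set b} (⟦_⟧ : Atom → CommutativeSemiring.Carrier R)
  (degree : Atom → Fin n → ℕ) (size : Atom → ℕ)
  where

  open CommutativeSemiring R hiding (zero)
  open ListSums R
  open Programs R Supported
  open SumsOfProducts R ⟦_⟧ degree size

  Small : Program N → ℕ → ℕ → Set _
  Small {N} P t Y = ∀ u o → boundOf P o ⊑ bound P u → weight P u ≤ weightOf P o ℕ.+ t →
    Σ Atom λ a → degree a ⊑ (λ i → bound P u i ∸ boundOf P o i) × size a < Y × ⟦ a ⟧ ≈ valueTo P u o

  module FromSmall
    {N} (P : Program N) (S t Y : ℕ) (1≤t : 1 ≤ t) (1≤S : 1 ≤ S) (arcs≤S : length (arcs P) ≤ S)
    (small : Small P t Y)
    where

    private
      instance
        t≢0 = >-nonZero 1≤t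

    -- `e` counts cuts: each one chooses among at most `S` arcs and adds two factors.
    Expanded : ℕ → Fin N → Maybe (Fin N) → Set _
    Expanded e u o =
      SumOfProducts (λ i → bound P u i ∸ boundOf P o i) (valueTo P u o) (S ℕ.^ e) (1 ℕ.+ 2 ℕ.* e) Y

    1≤S^ : ∀ e → 1 ≤ S ℕ.^ e
    1≤S^ e = ℕ.m^n>0 S {{>-nonZero 1≤S}} e

    expand-small : ∀ e u o → boundOf P o ⊑ bound P u → weight P u ≤ weightOf P o ℕ.+ t → Expanded e u o
    expand-small e u o o⊑u u≤ with (a , a⊑ , a<Y , a≈) ← small u o o⊑u u≤ =
      weaken (λ _ → ℕ.≤-refl) refl (1≤S^ e) (s≤s z≤n) (atom a a⊑ a<Y a≈)

    weightOf-nothing : weightOf P nothing ≡ 0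
    weightOf-nothing = sum-replicate-zero n

    Splits : ℕ → Fin N → Maybe (Fin N) → Arc N → Set _
    Splits e u o (w , c , h) = Σ ℕ λ e₁ → Σ ℕ λ e₂ → e₁ ℕ.+ e₂ ≤ e × Expanded e₁ u (just w) × Expanded e₂ c nothing

    expand-step : ∀ e u o → weightOf P o ℕ.+ t < weight P u →
                  (∀ {f@(w , c , h) : Arc N} → f ∈ arcs P → Cut P (weightOf P o ℕ.+ t) u o f → Splits e u o f) →
                  Expanded (suc e) u o
    expand-step e u o θ<u splits =
      weaken (λ _ → ℕ.≤-refl) (sym (valueTo-cut P θ u o (ℕ.≤-trans 1≤t (ℕ.m≤n+m t _)) (ℕ.m≤m+n _ t) θ<u))
             (ℕ.*-monoˡ-≤ (S ℕ.^ e) (ℕ.≤-trans (List.length-filter (cut? P θ u o) (arcs P)) arcs≤S))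
             ℕ.≤-refl
             (sums (filter (cut? P θ u o) (arcs P)) (λ f∈ →
               let (f∈ , cut) = ∈.∈-filter⁻ (cut? P θ u o) {xs = arcs P} f∈ in term f∈ cut))
      where
      -- Measured from the target, so that the factor from `h` to `o` below the cut has relative
      -- weight at most `t` and is an atom at once.
      θ = weightOf P o ℕ.+ t

      length≤ : ∀ e₁ e₂ → e₁ ℕ.+ e₂ ≤ e →
                   1 ℕ.+ 2 ℕ.* e₁ ℕ.+ (1 ℕ.+ 2 ℕ.* e₂ ℕ.+ 1) ≤ 1 ℕ.+ 2 ℕ.* suc e
      length≤ e₁ e₂ e₁+e₂≤e = begin
        1 ℕ.+ 2 ℕ.* e₁ ℕ.+ (1 ℕ.+ 2 ℕ.* e₂ ℕ.+ 1) ≡⟨ solve 2 (λ x y → con 1 :+ con 2 :* x :+ (con 1 :+ con 2 :* y :+ con 1)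
                                                          := con 1 :+ con 2 :* (con 1 :+ (x :+ y))) ≡.refl e₁ e₂ ⟩
        1 ℕ.+ 2 ℕ.* suc (e₁ ℕ.+ e₂)              ≤⟨ s≤s (ℕ.*-monoʳ-≤ 2 (s≤s e₁+e₂≤e)) ⟩
        1 ℕ.+ 2 ℕ.* suc e                        ∎
        where
        open ℕ.≤-Reasoning
        open +-*-Solver

      -- The differences telescope because `c + h ≤ w` at an arc; the comparisons exclude
      -- truncation.
      combine : ∀ {u w c h o} → w ≤ u → o ≤ h → c ℕ.+ h ≤ w → (u ∸ w) ℕ.+ (c ℕ.+ (h ∸ o)) ≤ u ∸ o
      combine {u} {w} {c} {h} {o} w≤u o≤h c+h≤w = begin
        (u ∸ w) ℕ.+ (c ℕ.+ (h ∸ o)) ≡⟨ ≡.cong ((u ∸ w) ℕ.+_) (ℕ.+-∸-assoc c o≤h) ⟨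
        (u ∸ w) ℕ.+ ((c ℕ.+ h) ∸ o) ≤⟨ ℕ.+-monoʳ-≤ (u ∸ w) (ℕ.∸-monoˡ-≤ o c+h≤w) ⟩
        (u ∸ w) ℕ.+ (w ∸ o)         ≡⟨ ℕ.+-∸-assoc (u ∸ w) (ℕ.≤-trans o≤h (ℕ.≤-trans (ℕ.m≤n+m h c) c+h≤w)) ⟨
        ((u ∸ w) ℕ.+ w) ∸ o         ≡⟨ ≡.cong (_∸ o) (ℕ.m∸n+n≡m w≤u) ⟩
        u ∸ o                       ∎
        where open ℕ.≤-Reasoning

      term : ∀ {f@(w , c , h) : Arc N} → f ∈ arcs P → Cut P θ u o f →
             SumOfProducts (λ i → bound P u i ∸ boundOf P o i) (paths P u w * (value P c * valueTo P h o))
                           (S ℕ.^ e) (1 ℕ.+ 2 ℕ.* suc e) Y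
      term {w , c , h} f∈ cut@((θ<w , h≤θ) , w⊑u , o⊑h)
        with (e₁ , e₂ , e₁+e₂≤e , s₁ , s₂) ← splits f∈ cut
        with (a , a⊑ , a<Y , a≈) ← small h o o⊑h h≤θ =
        weaken (λ i → combine (w⊑u i) (o⊑h i) (proj₁ (All.lookup (arc-bound P) f∈) i)) refl
               (begin
                 S ℕ.^ e₁ ℕ.* (S ℕ.^ e₂ ℕ.* 1) ≡⟨ ≡.cong (S ℕ.^ e₁ ℕ.*_) (ℕ.*-identityʳ _) ⟩
                 S ℕ.^ e₁ ℕ.* S ℕ.^ e₂         ≡⟨ ℕ.^-distribˡ-+-* S e₁ e₂ ⟨
                 S ℕ.^ (e₁ ℕ.+ e₂)             ≤⟨ ℕ.^-monoʳ-≤ S {{>-nonZero 1≤S}} e₁+e₂≤e ⟩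
                 S ℕ.^ e                       ∎)
               (length≤ e₁ e₂ e₁+e₂≤e)
               (s₁ · (s₂ · atom a a⊑ a<Y a≈))
        where open ℕ.≤-Reasoning

    private
      -- A path of weight d is expanded about 2d/t times and the value of a vertex
      -- of weight d > t once less.  Each expansion leaves a prefix lighter by t,
      -- which pays for two steps, unless its light sibling weighs more than t;
      -- then the saving on the sibling pays for it.
      ContextsExpand : ℕ → Set _
      ContextsExpand d = ∀ e → 2 ℕ.* d < suc e ℕ.* t → ∀ u v → bound P v ⊑ bound P u →
                         weight P u ≤ d ℕ.+ weight P v → Expanded e u (just v)

      -- A vertex w on the heavy path with weight more than o + t splits off a
      -- weight of at least t.
      prefix : ∀ {u w o d} → w ≤ u → o ℕ.+ t < w → u ≤ d ℕ.+ o → (u ∸ w) ℕ.+ t < d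
      prefix {u} {w} {o} {d} w≤u o+t<w u≤d+o = ℕ.+-cancelʳ-< o _ _ (begin-strict
        (u ∸ w) ℕ.+ t ℕ.+ o   ≡⟨ ℕ.+-assoc (u ∸ w) t o ⟩
        (u ∸ w) ℕ.+ (t ℕ.+ o) ≡⟨ ≡.cong ((u ∸ w) ℕ.+_) (ℕ.+-comm t o) ⟩
        (u ∸ w) ℕ.+ (o ℕ.+ t) <⟨ ℕ.+-monoʳ-< (u ∸ w) o+t<w ⟩
        (u ∸ w) ℕ.+ w         ≡⟨ ℕ.m∸n+n≡m w≤u ⟩
        u                     ≤⟨ u≤d+o ⟩
        d ℕ.+ o               ∎)
        where open ℕ.≤-Reasoning

      drop-2t : ∀ k {x d} → x ℕ.+ t < d → 2 ℕ.* d < (2 ℕ.+ k) ℕ.* t → 2 ℕ.* x < k ℕ.* t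
      drop-2t k {x} {d} x+t<d 2d< = ℕ.+-cancelʳ-< (2 ℕ.* t) _ _ (begin-strict
        2 ℕ.* x ℕ.+ 2 ℕ.* t   ≡⟨ ℕ.*-distribˡ-+ 2 x t ⟨
        2 ℕ.* (x ℕ.+ t)       <⟨ ℕ.*-monoʳ-< 2 x+t<d ⟩
        2 ℕ.* d               <⟨ 2d< ⟩
        (2 ℕ.+ k) ℕ.* t       ≡⟨ ℕ.*-distribʳ-+ t 2 k ⟩
        2 ℕ.* t ℕ.+ k ℕ.* t   ≡⟨ ℕ.+-comm (2 ℕ.* t) _ ⟩
        k ℕ.* t ℕ.+ 2 ℕ.* t   ∎)
        where open ℕ.≤-Reasoning

      2< : ∀ {d} k → t < d → 2 ℕ.* d < k ℕ.* t → 2 < k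
      2< k t<d 2d< = ℕ.*-cancelʳ-< t 2 k (ℕ.<-trans (ℕ.*-monoʳ-< 2 t<d) 2d<)

      -- Without a target the threshold is `t` itself, and the light sibling weighs no more than
      -- `h`, hence at most `t`: only the prefix recurses, which is where one cut is saved.
      -- Recursion below `d` is an argument because `expand-context-from` calls this lemma at the
      -- weight of a light sibling, which can be as large as its own `d`.
      expand-value-from : ∀ d → (∀ {d′} → d′ < d → ContextsExpand d′) →
        ∀ e → 2 ℕ.* d < (2 ℕ.+ e) ℕ.* t → ∀ u → weight P u ≤ d → Expanded e u nothing
      expand-value-from d rec e 2d< u u≤d with weight P u ℕ.≤? weightOf P nothing ℕ.+ t
      ... | yes u≤t = expand-small e u nothing (λ _ → z≤n) u≤t
      -- With no cut left, `2d < 2t`, which would make `u` light.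
      expand-value-from d rec zero 2d< u u≤d | no u≰t =
        contradiction
          (2< 2 (ℕ.<-≤-trans (≡.subst (λ z → z ℕ.+ t < weight P u) weightOf-nothing (ℕ.≰⇒> u≰t)) u≤d) 2d<)
          (ℕ.<-irrefl ≡.refl)
      expand-value-from d rec (suc e) 2d< u u≤d | no u≰t =
        expand-step e u nothing (ℕ.≰⇒> u≰t) λ {(w , c , h)} f∈ ((θ<w , h≤θ) , w⊑u , _) →
          let w≤u = total-mono w⊑u
              pre = prefix {o = 0} w≤u (≡.subst (λ z → z ℕ.+ t < weight P w) weightOf-nothing θ<w)
                           (ℕ.≤-trans u≤d (ℕ.m≤m+n d 0))
          in e , 0 , ℕ.≤-reflexive (ℕ.+-identityʳ e) ,
             rec (ℕ.≤-<-trans (ℕ.m≤m+n _ t) pre) e (drop-2t (suc e) pre 2d<)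
                 u w w⊑u (ℕ.≤-reflexive (≡.sym (ℕ.m∸n+n≡m w≤u))) ,
             expand-small 0 c nothing (λ _ → z≤n) (ℕ.≤-trans (proj₂ (All.lookup (arc-bound P) f∈)) h≤θ)

      expand-context-from : ∀ d → (∀ {d′} → d′ < d → ContextsExpand d′) → ContextsExpand d
      expand-context-from d rec e 2d< u v v⊑u u≤d+v with weight P u ℕ.≤? weight P v ℕ.+ t
      ... | yes u≤v+t = expand-small e u (just v) v⊑u u≤v+t
      ... | no  u≰v+t = big e 2d< (2< (suc e) t<d 2d<)
        where
        t<d : t < d
        t<d = ℕ.+-cancelʳ-< (weight P v) _ _
          (ℕ.<-≤-trans (≡.subst (_< weight P u) (ℕ.+-comm (weight P v) t) (ℕ.≰⇒> u≰v+t)) u≤d+v)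

        -- Since `d > t`, the budget is at least two cuts, which rules out the first two clauses.
        big : ∀ e → 2 ℕ.* d < suc e ℕ.* t → 2 < suc e → Expanded e u (just v)
        big zero          _   (s≤s ())
        big (suc zero)    _   (s≤s (s≤s ()))
        big (suc (suc e)) 2d< _ = expand-step (suc e) u (just v) (ℕ.≰⇒> u≰v+t) splits
          where
          splits : ∀ {f@(w , c , h) : Arc N} → f ∈ arcs P → Cut P (weight P v ℕ.+ t) u (just v) f → Splits (suc e) u (just v) f
          splits {w , c , h} f∈ ((θ<w , _) , w⊑u , v⊑h) with weight P c ℕ.≤? weightOf P nothing ℕ.+ t
          ... | yes c≤t = e , 0 , ℕ.≤-trans (ℕ.≤-reflexive (ℕ.+-identityʳ e)) (ℕ.n≤1+n e) ,
                rec (ℕ.≤-<-trans (ℕ.m≤m+n _ t) pre) e (drop-2t (suc e) pre 2d<)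
                    u w w⊑u (ℕ.≤-reflexive (≡.sym (ℕ.m∸n+n≡m w≤u))) ,
                expand-small 0 c nothing (λ _ → z≤n) c≤t
            where
            w≤u = total-mono w⊑u
            pre = prefix w≤u θ<w u≤d+v
          ... | no  c≰t = e₁ , e₂ , ℕ.≤-reflexive e₁+e₂≡ ,
                rec d₁<d e₁ 2d₁< u w w⊑u (ℕ.≤-reflexive (≡.sym (ℕ.m∸n+n≡m w≤u))) ,
                expand-value-from (weight P c) (λ d′<c → rec (ℕ.<-≤-trans d′<c (ℕ.≤-trans (ℕ.m≤n+m _ d₁) d₁+c≤d)))
                                  e₂ 2c< c ℕ.≤-refl
            where
            open ℕ.≤-Reasoning
            open +-*-Solver
            w≤u = total-mono w⊑u
            pre = prefix w≤u θ<w u≤d+v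
            d₁ = weight P u ∸ weight P w
            d₁<d = ℕ.≤-<-trans (ℕ.m≤m+n _ t) pre
            -- The least budget that `ContextsExpand` admits for weight `d₁`. The rest goes to the
            -- light sibling, whose value needs one cut less than a path of its weight; that cut is
            -- the present one.
            e₁ = 2 ℕ.* d₁ ℕ./ t
            e₂ = suc e ∸ e₁

            e₁t≤ : e₁ ℕ.* t ≤ 2 ℕ.* d₁
            e₁t≤ = m/n*n≤m (2 ℕ.* d₁) t

            2d₁< : 2 ℕ.* d₁ < suc e₁ ℕ.* t
            2d₁< = ≡.subst (_< suc e₁ ℕ.* t) (≡.sym (m≡m%n+[m/n]*n (2 ℕ.* d₁) t))
                           (ℕ.+-monoˡ-< (e₁ ℕ.* t) (m%n<n (2 ℕ.* d₁) t))

            e₁≤ : e₁ ≤ suc e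
            e₁≤ = ℕ.<⇒≤ (ℕ.*-cancelʳ-< t e₁ (suc e)
              (ℕ.≤-<-trans e₁t≤ (drop-2t (suc e) pre 2d<)))

            e₁+e₂≡ : e₁ ℕ.+ e₂ ≡ suc e
            e₁+e₂≡ = ℕ.m+[n∸m]≡n e₁≤

            d₁+c≤d : d₁ ℕ.+ weight P c ≤ d
            d₁+c≤d = ℕ.+-cancelʳ-≤ (weight P v) _ _ (begin
              d₁ ℕ.+ weight P c ℕ.+ weight P v    ≤⟨ ℕ.+-monoʳ-≤ (d₁ ℕ.+ weight P c) (total-mono v⊑h) ⟩
              d₁ ℕ.+ weight P c ℕ.+ weight P h    ≡⟨ ℕ.+-assoc d₁ _ _ ⟩
              d₁ ℕ.+ (weight P c ℕ.+ weight P h)  ≡⟨ ≡.cong (d₁ ℕ.+_) (∑-distrib-+ (bound P c) (bound P h)) ⟨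
              d₁ ℕ.+ total (λ i → bound P c i ℕ.+ bound P h i)
                                                  ≤⟨ ℕ.+-monoʳ-≤ d₁ (total-mono (proj₁ (All.lookup (arc-bound P) f∈))) ⟩
              d₁ ℕ.+ weight P w                   ≡⟨ ℕ.m∸n+n≡m w≤u ⟩
              weight P u                          ≤⟨ u≤d+v ⟩
              d ℕ.+ weight P v                    ∎)

            2c< : 2 ℕ.* weight P c < (2 ℕ.+ e₂) ℕ.* t
            2c< = ℕ.+-cancelˡ-< (2 ℕ.* d₁) _ _ (begin-strict
              2 ℕ.* d₁ ℕ.+ 2 ℕ.* weight P c       ≡⟨ ℕ.*-distribˡ-+ 2 d₁ (weight P c) ⟨
              2 ℕ.* (d₁ ℕ.+ weight P c)           ≤⟨ ℕ.*-monoʳ-≤ 2 d₁+c≤d ⟩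
              2 ℕ.* d                             <⟨ 2d< ⟩
              (2 ℕ.+ suc e) ℕ.* t                 ≡⟨ ≡.cong (λ k → (2 ℕ.+ k) ℕ.* t) e₁+e₂≡ ⟨
              (2 ℕ.+ (e₁ ℕ.+ e₂)) ℕ.* t           ≡⟨ ≡.cong (ℕ._* t) (solve 2 (λ x y → con 2 :+ (x :+ y) := x :+ (con 2 :+ y))
                                                                    ≡.refl e₁ e₂) ⟩
              (e₁ ℕ.+ (2 ℕ.+ e₂)) ℕ.* t           ≡⟨ ℕ.*-distribʳ-+ t e₁ (2 ℕ.+ e₂) ⟩
              e₁ ℕ.* t ℕ.+ (2 ℕ.+ e₂) ℕ.* t       ≤⟨ ℕ.+-monoˡ-≤ _ e₁t≤ ⟩
              2 ℕ.* d₁ ℕ.+ (2 ℕ.+ e₂) ℕ.* t       ∎)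

      contexts-expand : ∀ d → ContextsExpand d
      contexts-expand = <-rec ContextsExpand λ d rec → expand-context-from d rec

      ratio : ∀ r → 2 ℕ.* (r ℕ.* t) < suc (2 ℕ.* r) ℕ.* t
      ratio r = ℕ.≤-<-trans (ℕ.≤-reflexive (≡.sym (ℕ.*-assoc 2 r t))) (ℕ.m<n+m _ 1≤t)

    -- The budget is the quotient `2d / t` for `d = r * t`.
    expand : ∀ r u o → boundOf P o ⊑ bound P u → weight P u ≤ r ℕ.* t ℕ.+ weightOf P o →
             Expanded (2 ℕ.* r) u o
    expand r u (just v) v⊑u u≤ = contexts-expand (r ℕ.* t) (2 ℕ.* r) (ratio r) u v v⊑u u≤
    expand r u nothing  _   u≤ =
      expand-value-from (r ℕ.* t) (λ {d′} _ → contexts-expand d′) (2 ℕ.* r)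
        (ℕ.<-trans (ratio r) (ℕ.m<n+m _ 1≤t)) u
        (≡.subst (weight P u ≤_)
          (≡.trans (≡.cong (r ℕ.* t ℕ.+_) weightOf-nothing) (ℕ.+-identityʳ _)) u≤)

-- Layered formulas and their compilation into circuits

module Formulas (F : HeytingField a ℓ₁ ℓ₂) (n Δ : ℕ) where

  open Polynomials F
  open HeytingField F using (Carrier; 0#; 1#)
  private module R = CommutativeSemiring (polynomials n)
  open ListSums (polynomials n)

  private
    variable
      l : ℕ

  -- Formulas whose root may stand in layer l.  Gates compute the sum or product
  -- of a list of formulas and of the constant 0 or 1, as gates need an input.
  data Formula (l : ℕ) : Set a where
    var   : Fin n → Formula l
    const : Carrier → Formula l
    sum   : l < 2 ℕ.* Δ → l ℕ.% 2 ≡ 0 → List (Formula (suc l)) → Formula l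
    prod  : l < 2 ℕ.* Δ → l ℕ.% 2 ≡ 1 → List (Formula (suc l)) → Formula l

  mutual
    ⟦_⟧ : Formula l → Polynomial n
    ⟦ var i ⟧       = varP i
    ⟦ const c ⟧     = constP c
    ⟦ sum _ _ φs ⟧  = foldr _⊕_ (constP 0#) ⟦ φs ⟧s
    ⟦ prod _ _ φs ⟧ = foldr _⊗_ (constP 1#) ⟦ φs ⟧s

    ⟦_⟧s : List (Formula l) → List (Polynomial n)
    ⟦ [] ⟧s     = []
    ⟦ φ ∷ φs ⟧s = ⟦ φ ⟧ ∷ ⟦ φs ⟧s

  mutual
    degreeOf : Formula l → Fin n → ℕ
    degreeOf (var j)       i = unit j i
    degreeOf (const c)     i = 0
    degreeOf (sum _ _ φs)  i = foldr _⊔_ 0 (degreesOf φs i)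
    degreeOf (prod _ _ φs) i = foldr ℕ._+_ 0 (degreesOf φs i)

    degreesOf : List (Formula l) → Fin n → List ℕ
    degreesOf []       i = []
    degreesOf (φ ∷ φs) i = degreeOf φ i ∷ degreesOf φs i

  mutual
    -- The edges of the compiled circuit: `suc` at a gate is its edge to the added constant, `suc`
    -- in `sizesOf` the edge to an input.
    sizeOf : Formula l → ℕ
    sizeOf (var i)       = 0
    sizeOf (const c)     = 0
    sizeOf (sum _ _ φs)  = suc (sizesOf φs)
    sizeOf (prod _ _ φs) = suc (sizesOf φs)

    sizesOf : List (Formula l) → ℕ
    sizesOf []       = 0
    sizesOf (φ ∷ φs) = suc (sizeOf φ) ℕ.+ sizesOf φs

  ⟦⟧s≡map : ∀ (φs : List (Formula l)) → ⟦ φs ⟧s ≡ map ⟦_⟧ φs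
  ⟦⟧s≡map []       = ≡.refl
  ⟦⟧s≡map (φ ∷ φs) = ≡.cong (⟦ φ ⟧ ∷_) (⟦⟧s≡map φs)

  degreesOf≡map : ∀ (φs : List (Formula l)) i → degreesOf φs i ≡ map (λ φ → degreeOf φ i) φs
  degreesOf≡map []       i = ≡.refl
  degreesOf≡map (φ ∷ φs) i = ≡.cong (degreeOf φ i ∷_) (degreesOf≡map φs i)

  sizesOf≤ : ∀ (φs : List (Formula l)) {Y} → All (λ φ → sizeOf φ < Y) φs → sizesOf φs ≤ length φs ℕ.* Y
  sizesOf≤ []       []         = z≤n
  sizesOf≤ (φ ∷ φs) (φ<Y ∷ <Y) = ℕ.+-mono-≤ φ<Y (sizesOf≤ φs <Y)

  module Compile (k : ℕ) where

    record Network : Set a where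
      field
        {vertices} : ℕ
        dag        : Dag Carrier n vertices
        layer      : Fin vertices → ℕ
        inLayer    : ∀ u → InLayer Δ dag layer (layer u) (vertex dag u)
        multiIc    : ∀ u i → Var dag u i ≤ k

    open Network public

    polyAt : (S : Network) → Fin (vertices S) → Polynomial n
    polyAt S = polynomialAt F (dag S)

    At : (S : Network) → ℕ → Fin (vertices S) → Set
    At S l u = IsLeaf (vertex (dag S) u) ⊎ layer S u ≡ l

    -- Inputs compiled early must stay usable while later ones are appended; these are the data that
    -- have to survive the renumbering.
    record _⟶_ (S S′ : Network) : Set a where
      field
        embed : Fin (vertices S) → Fin (vertices S′)
        poly≡ : ∀ u → polyAt S′ (embed u) ≡ polyAt S u
        var≡  : ∀ u i → Var (dag S′) (embed u) i ≡ Var (dag S) u i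
        at    : ∀ {l} u → At S l u → At S′ l (embed u)

    open _⟶_

    id⟶ : ∀ {S} → S ⟶ S
    id⟶ = record { embed = λ u → u ; poly≡ = λ _ → ≡.refl ; var≡ = λ _ _ → ≡.refl ; at = λ _ p → p }

    infixr 5 _⟫_
    _⟫_ : ∀ {S S′ S″} → S ⟶ S′ → S′ ⟶ S″ → S ⟶ S″
    f ⟫ g = record
      { embed = embed g ∘ embed f
      ; poly≡ = λ u → ≡.trans (poly≡ g (embed f u)) (poly≡ f u)
      ; var≡  = λ u i → ≡.trans (var≡ g (embed f u) i) (var≡ f u i)
      ; at    = λ u p → at g (embed f u) (at f u p)
      }

    isLeaf-suc : ∀ {N} (x : Vertex Carrier n (Fin N)) → IsLeaf x → IsLeaf (mapVertex Fin.suc x)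
    isLeaf-suc (var _)   _ = tt
    isLeaf-suc (const _) _ = tt

    layer-▷ : ∀ {N} → ℕ → (Fin N → ℕ) → Fin (suc N) → ℕ
    layer-▷ l f zero    = l
    layer-▷ l f (suc u) = f u

    module _ (S : Network) (g : Vertex Carrier n (Fin (vertices S))) (l : ℕ) where

      inputFor-▷ : ∀ {l′ v} → InputFor Δ (dag S) (layer S) l′ v →
                   InputFor Δ (dag S ▷ g) (layer-▷ l (layer S)) l′ (suc v)
      inputFor-▷ {v = v} (inj₁ leaf) = inj₁ (isLeaf-suc (vertex (dag S) v) leaf)
      inputFor-▷         (inj₂ eq)   = inj₂ eq

      inLayer-▷ : ∀ {l′} x → InLayer Δ (dag S) (layer S) l′ x →
                  InLayer Δ (dag S ▷ g) (layer-▷ l (layer S)) l′ (mapVertex suc x)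
      inLayer-▷ (var _)         _             = tt
      inLayer-▷ (const _)       _             = tt
      inLayer-▷ (sum (u ∷ us))  (<2Δ , even , p ∷ ps) = <2Δ , even , inputFor-▷ p ∷ All.map⁺ (All.map inputFor-▷ ps)
      inLayer-▷ (prod (u ∷ us)) (<2Δ , odd  , p ∷ ps) = <2Δ , odd  , inputFor-▷ p ∷ All.map⁺ (All.map inputFor-▷ ps)

      extend : InLayer Δ (dag S) (layer S) l g → (∀ i → Var (dag S ▷ g) zero i ≤ k) → Network
      extend ok ≤k = record
        { dag     = dag S ▷ g
        ; layer   = layer-▷ l (layer S)
        ; inLayer = λ { zero → inLayer-▷ g ok ; (suc u) → inLayer-▷ (vertex (dag S) u) (inLayer S u) }
        ; multiIc = λ { zero → ≤k ; (suc u) → multiIc S u }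
        }

      extend⟶ : ∀ ok ≤k → S ⟶ extend ok ≤k
      extend⟶ ok ≤k = record
        { embed = suc
        ; poly≡ = λ _ → ≡.refl
        ; var≡  = λ _ _ → ≡.refl
        ; at    = λ { u (inj₁ leaf) → inj₁ (isLeaf-suc (vertex (dag S) u) leaf) ; u (inj₂ eq) → inj₂ eq }
        }

    record Computes (S : Network) {l : ℕ} (u : Fin (vertices S)) (φ : Formula l) : Set (a Level.⊔ ℓ₁) where
      constructor computes
      field
        poly≋    : polyAt S u ≋ ⟦ φ ⟧
        var≡     : ∀ i → Var (dag S) u i ≡ degreeOf φ i
        position : At S l u

    computes⟶ : ∀ {S S′ u} {φ : Formula l} → (f : S ⟶ S′) → Computes S u φ → Computes S′ (embed f u) φ
    computes⟶ {u = u} f (computes p v q) = computes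
      (R.trans (R.reflexive (poly≡ f u)) p) (λ i → ≡.trans (var≡ f u i) (v i)) (at f u q)

    -- Every formula gets fresh vertices, even if an equal one is already present, so that edges add
    -- up exactly.
    record Compiled (S : Network) {l : ℕ} (φ : Formula l) : Set (a Level.⊔ ℓ₁) where
      constructor compiled
      field
        network    : Network
        embedding  : S ⟶ network
        root       : Fin (vertices network)
        root-value : Computes network root φ
        edges≡     : edges (dag network) ≡ edges (dag S) ℕ.+ sizeOf φ

    record CompiledList (S : Network) {l : ℕ} (φs : List (Formula l)) : Set (a Level.⊔ ℓ₁) where
      constructor compiled
      field
        network     : Network
        embedding   : S ⟶ network
        roots       : List (Fin (vertices network))
        root-values : Pointwise (Computes network) roots φs
        -- `sizesOf` already counts the edges to the roots, which only the gate above will create.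
        edges≡      : edges (dag network) ℕ.+ length roots ≡ edges (dag S) ℕ.+ sizesOf φs

    sum-computes : ∀ {S us} {φs : List (Formula l)} → Pointwise (Computes S) us φs →
                   foldr _⊕_ (constP 0#) (map (polyAt S) us) ≋ foldr _⊕_ (constP 0#) ⟦ φs ⟧s
    sum-computes []                                  = R.refl
    sum-computes {φs = φ ∷ φs} (computes p _ _ ∷ cs) =
      R.+-cong {y = ⟦ φ ⟧} {v = foldr _⊕_ (constP 0#) ⟦ φs ⟧s} p (sum-computes cs)

    prod-computes : ∀ {S us} {φs : List (Formula l)} → Pointwise (Computes S) us φs →
                    foldr _⊗_ (constP 1#) (map (polyAt S) us) ≋ foldr _⊗_ (constP 1#) ⟦ φs ⟧s
    prod-computes []                     = R.refl
    prod-computes (computes p _ _ ∷ cs) = R.*-cong p (prod-computes cs)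

    vars-computes : ∀ {S us} {φs : List (Formula l)} → Pointwise (Computes S) us φs →
                    ∀ i → map (λ u → Var (dag S) u i) us ≡ degreesOf φs i
    vars-computes []                     i = ≡.refl
    vars-computes (computes _ v _ ∷ cs) i = ≡.cong₂ _∷_ (v i) (vars-computes cs i)

    at-computes : ∀ {S us} {φs : List (Formula l)} → Pointwise (Computes S) us φs → All (At S l) us
    at-computes []                     = []
    at-computes (computes _ _ q ∷ cs) = q ∷ at-computes cs

    Bounded : List (Formula l) → Set a
    Bounded = All (λ φ → ∀ i → degreeOf φ i ≤ k)

    max-bounded : ∀ (φs : List (Formula l)) → (∀ i → foldr _⊔_ 0 (degreesOf φs i) ≤ k) → Bounded φs
    max-bounded []       _  = []
    max-bounded (φ ∷ φs) ≤k = (λ i → ℕ.≤-trans (ℕ.m≤m⊔n _ _) (≤k i)) ∷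
      max-bounded φs (λ i → ℕ.≤-trans (ℕ.m≤n⊔m (degreeOf φ i) _) (≤k i))

    sum-bounded : ∀ (φs : List (Formula l)) → (∀ i → foldr ℕ._+_ 0 (degreesOf φs i) ≤ k) → Bounded φs
    sum-bounded []       _  = []
    sum-bounded (φ ∷ φs) ≤k = (λ i → ℕ.≤-trans (ℕ.m≤m+n _ _) (≤k i)) ∷
      sum-bounded φs (λ i → ℕ.≤-trans (ℕ.m≤n+m _ (degreeOf φ i)) (≤k i))

    module Gate (S : Network) (l : ℕ) (φs : List (Formula (suc l))) (c : Carrier)
                (inputs : CompiledList S φs) where
      open CompiledList inputs

      withConst : Network
      withConst = extend network (const c) (suc l) tt (λ _ → z≤n)

      network⟶ : network ⟶ withConst
      network⟶ = extend⟶ network (const c) (suc l) tt (λ _ → z≤n)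

      heads : Pointwise (Computes withConst) (zero ∷ map suc roots) (const c ∷ φs)
      heads = computes R.refl (λ _ → ≡.refl) (inj₁ tt) ∷ go root-values
        where
        go : ∀ {us} {φs : List (Formula (suc l))} → Pointwise (Computes network) us φs →
             Pointwise (Computes withConst) (map suc us) φs
        go []       = []
        go (c ∷ cs) = computes⟶ network⟶ c ∷ go cs

      edges-gate : edges (dag network) ℕ.+ 0 ℕ.+ suc (length (map (Fin.suc {vertices network}) roots)) ≡
                   edges (dag S) ℕ.+ suc (sizesOf φs)
      edges-gate = begin
        edges (dag network) ℕ.+ 0 ℕ.+ suc (length (map (Fin.suc {vertices network}) roots))
          ≡⟨ ≡.cong₂ (λ x y → x ℕ.+ suc y) (ℕ.+-identityʳ _) (List.length-map Fin.suc roots) ⟩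
        edges (dag network) ℕ.+ suc (length roots)    ≡⟨ ℕ.+-suc _ _ ⟩
        suc (edges (dag network) ℕ.+ length roots)    ≡⟨ ≡.cong suc edges≡ ⟩
        suc (edges (dag S) ℕ.+ sizesOf φs)              ≡⟨ ℕ.+-suc _ _ ⟨
        edges (dag S) ℕ.+ suc (sizesOf φs)              ∎
        where open ≡.≡-Reasoning

    mutual
      compile : ∀ S (φ : Formula l) → (∀ i → degreeOf φ i ≤ k) → Compiled S φ
      compile {l} S (var j) ≤k = compiled (extend S (var j) l tt ≤k) (extend⟶ S (var j) l tt ≤k) zero
        (computes R.refl (λ _ → ≡.refl) (inj₁ tt)) ≡.refl
      compile {l} S (const c) ≤k = compiled (extend S (const c) l tt ≤k) (extend⟶ S (const c) l tt ≤k) zero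
        (computes R.refl (λ _ → ≡.refl) (inj₁ tt)) ≡.refl
      compile {l} S (sum <2Δ even φs) ≤k = compileSum S φs <2Δ even ≤k
      compile {l} S (prod <2Δ odd φs) ≤k = compiled S″ (embedding ⟫ network⟶ ⟫ S′⟶S″) zero
        (computes (R.trans (prod-computes heads) (R.*-identityˡ _)) deg (inj₂ ≡.refl)) edges-gate
        where
        inputs = compileList S φs (sum-bounded φs ≤k)
        open CompiledList inputs
        open Gate S l φs 1# inputs
        deg : ∀ i → foldr ℕ._+_ 0 (map (λ u → Var (dag withConst) u i) (zero ∷ map suc roots)) ≡ degreeOf (prod <2Δ odd φs) i
        deg i = ≡.cong (foldr ℕ._+_ 0) (vars-computes heads i)
        ok : InLayer Δ (dag withConst) (layer withConst) l (prod (zero ∷ map suc roots))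
        ok = <2Δ , odd , at-computes heads
        deg≤ = λ i → ℕ.≤-trans (ℕ.≤-reflexive (deg i)) (≤k i)
        S″ = extend withConst (prod (zero ∷ map suc roots)) l ok deg≤
        S′⟶S″ = extend⟶ withConst (prod (zero ∷ map suc roots)) l ok deg≤

      compileSum : ∀ S (φs : List (Formula (suc l))) <2Δ even → (∀ i → degreeOf (sum <2Δ even φs) i ≤ k) →
                   Compiled S (sum <2Δ even φs)
      compileSum {l} S φs <2Δ even ≤k = compiled S″ (embedding ⟫ network⟶ ⟫ S′⟶S″) zero
        (computes (R.trans (sum-computes heads) (R.+-identityˡ _)) deg (inj₂ ≡.refl)) edges-gate
        where
        inputs = compileList S φs (max-bounded φs ≤k)
        open CompiledList inputs
        open Gate S l φs 0# inputs
        deg : ∀ i → foldr _⊔_ 0 (map (λ u → Var (dag withConst) u i) (zero ∷ map suc roots)) ≡ degreeOf (sum <2Δ even φs) i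
        deg i = ≡.cong (foldr _⊔_ 0) (vars-computes heads i)
        ok : InLayer Δ (dag withConst) (layer withConst) l (sum (zero ∷ map suc roots))
        ok = <2Δ , even , at-computes heads
        deg≤ = λ i → ℕ.≤-trans (ℕ.≤-reflexive (deg i)) (≤k i)
        S″ = extend withConst (sum (zero ∷ map suc roots)) l ok deg≤
        S′⟶S″ = extend⟶ withConst (sum (zero ∷ map suc roots)) l ok deg≤

      compileList : ∀ S (φs : List (Formula l)) → Bounded φs → CompiledList S φs
      compileList S []       []        = compiled S id⟶ [] [] ≡.refl
      compileList S (φ ∷ φs) (≤k ∷ ≤ks)
        with compiled S′ f u c eq ← compile S φ ≤k
        with compiled S″ g us cs eqs ← compileList S′ φs ≤ks =
        compiled S″ (f ⟫ g) (embed g u ∷ us) (computes⟶ g c ∷ cs) (begin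
          edges (dag S″) ℕ.+ suc (length us)            ≡⟨ ℕ.+-suc _ _ ⟩
          suc (edges (dag S″) ℕ.+ length us)            ≡⟨ ≡.cong suc eqs ⟩
          suc (edges (dag S′) ℕ.+ sizesOf φs)             ≡⟨ ≡.cong (λ e → suc (e ℕ.+ sizesOf φs)) eq ⟩
          suc (edges (dag S) ℕ.+ sizeOf φ ℕ.+ sizesOf φs)   ≡⟨ ≡.cong suc (ℕ.+-assoc (edges (dag S)) _ _) ⟩
          suc (edges (dag S) ℕ.+ (sizeOf φ ℕ.+ sizesOf φs)) ≡⟨ ℕ.+-suc _ _ ⟨
          edges (dag S) ℕ.+ (suc (sizeOf φ) ℕ.+ sizesOf φs) ∎)
        where open ≡.≡-Reasoning

    empty : Network
    empty = record { dag = [] ; layer = λ () ; inLayer = λ () ; multiIc = λ () }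

    circuit : ∀ (φs : List (Formula 1)) 0<2Δ even → (∀ i → degreeOf (sum 0<2Δ even φs) i ≤ k) →
              Σ (Circuit Carrier n) λ C → MultiIc k C × ProductDepth Δ C ×
                polynomial F C ≋ ⟦ sum 0<2Δ even φs ⟧ × size C ≡ sizeOf (sum 0<2Δ even φs)
    circuit φs 0<2Δ even ≤k =
      record { dag = dag network ; output = root } ,
      multiIc network ,
      -- The root is the last vertex, a sum gate put in layer 0, so both output conditions hold by
      -- computation.
      record { layer = layer network ; inLayer = inLayer network ; outputSum = tt ; outputLayer = ≡.refl } ,
      Computes.poly≋ root-value ,
      edges≡
      where open Compiled (compileSum empty φs 0<2Δ even ≤k)

-- Expansion into monomials

box : (Fin n → ℕ) → List (Vec ℕ n)
box {zero}  x = [] ∷ []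
box {suc n} x = cartesianProductWith _∷_ (upTo (suc (x zero))) (box (x ∘ suc))

n<2^n : ∀ n → n < 2 ℕ.^ n
n<2^n zero    = s≤s z≤n
n<2^n (suc n) = ℕ.+-mono-≤ (ℕ.m^n>0 2 n) (ℕ.≤-trans (n<2^n n) (ℕ.m≤m+n _ 0))

-- Coordinate by coordinate, from `1 + d ≤ 2 ^ d`; this makes the count depend on the weight alone.
length-box : ∀ {n} (x : Fin n → ℕ) → length (box x) ≤ 2 ℕ.^ total x
length-box {zero}  x = ℕ.≤-refl
length-box {suc n} x = begin
  length (cartesianProductWith _∷_ (upTo (suc (x zero))) (box (x ∘ suc)))
    ≡⟨ length-cartesianProductWith _∷_ (upTo (suc (x zero))) (box (x ∘ suc)) ⟩
  length (upTo (suc (x zero))) ℕ.* length (box (x ∘ suc))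
    ≤⟨ ℕ.*-mono-≤ (ℕ.≤-trans (ℕ.≤-reflexive (List.length-upTo (suc (x zero)))) (n<2^n (x zero))) (length-box (x ∘ suc)) ⟩
  2 ℕ.^ x zero ℕ.* 2 ℕ.^ total (x ∘ suc)
    ≡⟨ ℕ.^-distribˡ-+-* 2 (x zero) _ ⟨
  2 ℕ.^ total x ∎
  where open ℕ.≤-Reasoning

∈-box : ∀ {n} (x : Fin n → ℕ) m → lookup m ⊑ x → m ∈ box x
∈-box x []      m⊑x = here ≡.refl
∈-box x (d ∷ m) m⊑x = ∈.∈-cartesianProductWith⁺ _∷_ (∈.∈-upTo⁺ (s≤s (m⊑x zero))) (∈-box (x ∘ suc) m (m⊑x ∘ suc))

box-⊑ : ∀ {n} (x : Fin n → ℕ) {m} → m ∈ box x → lookup m ⊑ x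
box-⊑ {suc n} x m∈box i
  with (d , m , d∈ , m∈ , ≡.refl) ← ∈.∈-cartesianProductWith⁻ _∷_ (upTo (suc (x zero))) (box (x ∘ suc)) m∈box =
  coordinate i
  where
  coordinate : ∀ i → lookup (d ∷ m) i ≤ x i
  coordinate zero    = ℕ.≤-pred (∈.∈-upTo⁻ d∈)
  coordinate (suc i) = box-⊑ (x ∘ suc) m∈ i

box-unique : ∀ {n} (x : Fin n → ℕ) → Unique (box x)
box-unique {zero}  x = [] ∷ []
box-unique {suc n} x = Unique.cartesianProductWith⁺ _∷_ Vec.∷-injective (Unique.upTo⁺ (suc (x zero))) (box-unique (x ∘ suc))

factors : Vec ℕ n → List (Fin n)
factors []      = []
factors (d ∷ m) = List.replicate d zero ++ map suc (factors m)

length-factors : ∀ (m : Vec ℕ n) → length (factors m) ≡ total (lookup m)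
length-factors []      = ≡.refl
length-factors (d ∷ m) = ≡.trans (List.length-++ (List.replicate d zero))
  (≡.cong₂ ℕ._+_ (List.length-replicate d) (≡.trans (List.length-map suc (factors m)) (length-factors m)))

exponents : List (Fin n) → Vec ℕ n
exponents []       = replicate _ 0
exponents (j ∷ js) = zipWith ℕ._+_ (tabulate (unit j)) (exponents js)

lookup-exponents : ∀ (js : List (Fin n)) i → lookup (exponents js) i ≡ sumℕ (map (λ j → unit j i) js)
lookup-exponents []       i = Vec.lookup-replicate i 0
lookup-exponents (j ∷ js) i = ≡.trans (Vec.lookup-zipWith ℕ._+_ i (tabulate (unit j)) (exponents js))
  (≡.cong₂ ℕ._+_ (Vec.lookup∘tabulate (unit j) i) (lookup-exponents js i))

sum-factors : ∀ (m : Vec ℕ n) i → sumℕ (map (λ j → unit j i) (factors m)) ≡ lookup m i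
sum-factors (d ∷ m) i = ≡.trans (≡.cong sumℕ (List.map-++ _ (List.replicate d zero) _))
  (≡.trans (sum-++ (map (λ j → unit j i) (List.replicate d zero)) _)
  (≡.trans (≡.cong₂ (λ xs ys → sumℕ xs ℕ.+ sumℕ ys) (List.map-replicate (λ j → unit j i) d zero)
                                                   (≡.sym (List.map-∘ (factors m))))
           (parts i)))
  where
  sum-replicate : ∀ d c → sumℕ (List.replicate d c) ≡ d ℕ.* c
  sum-replicate zero    c = ≡.refl
  sum-replicate (suc d) c = ≡.cong (c ℕ.+_) (sum-replicate d c)

  zeros : ∀ (js : List (Fin _)) → sumℕ (map (λ j → unit (suc j) zero) js) ≡ 0
  zeros []       = ≡.refl
  zeros (j ∷ js) = zeros js

  parts : ∀ i → sumℕ (List.replicate d (unit zero i)) ℕ.+ sumℕ (map (λ j → unit (suc j) i) (factors m)) ≡ lookup (d ∷ m) i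
  parts zero    = ≡.trans (≡.cong₂ ℕ._+_ (≡.trans (sum-replicate d 1) (ℕ.*-identityʳ d)) (zeros (factors m))) (ℕ.+-identityʳ d)
  parts (suc i) = ≡.trans (≡.cong (ℕ._+ sumℕ (map (λ j → unit (suc j) (suc i)) (factors m)))
                                  (≡.trans (sum-replicate d 0) (ℕ.*-zeroʳ d)))
                          (sum-factors m i)

exponents-factors : ∀ (m : Vec ℕ n) → exponents (factors m) ≡ m
exponents-factors m = ≡.trans (≡.sym (Vec.tabulate∘lookup (exponents (factors m)))) (≡.trans
  (Vec.tabulate-cong (λ i → ≡.trans (lookup-exponents (factors m) i) (sum-factors m i)))
  (Vec.tabulate∘lookup m))

module BruteForce (F : HeytingField a ℓ₁ ℓ₂) (n Δ l : ℕ) where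

  open Polynomials F
  open CommutativeRing
    (HeytingCommutativeRing.commutativeRing (HeytingField.heytingCommutativeRing F))
    hiding (zero)
  private module R = CommutativeSemiring (polynomials n)
  open ListSums (polynomials n)
  open Formulas F n Δ using (Formula; var; const; ⟦_⟧; degreeOf; sizeOf)
  open SumsOfProducts (polynomials n) {Atom = Formula l} ⟦_⟧ degreeOf sizeOf

  term-cong : ∀ {c c′} (e : Vec ℕ n) → c ≈ c′ → term c e ≋ term c′ e
  term-cong e c≈c′ m with does (Vec.≡-dec ℕ._≟_ m e)
  ... | true  = c≈c′
  ... | false = refl

  monomial-value : ∀ js → ∏ (map (var {l}) js) ⟦_⟧ ≋ term 1# (exponents js)
  monomial-value []       = R.refl
  monomial-value (j ∷ js) = R.trans (R.*-congˡ {x = varP j} (monomial-value js)) (R.trans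
    (term-⊗ 1# (tabulate (unit j)) 1# (exponents js)) (term-cong (exponents (j ∷ js)) (*-identityˡ 1#)))

  monomial : Polynomial n → Vec ℕ n → List (Formula l)
  monomial p m = const (p m) ∷ map var (factors m)

  ∏-monomial : ∀ (p : Polynomial n) m → ∏ (monomial p m) ⟦_⟧ ≋ term (p m) m
  ∏-monomial p m = R.trans (R.*-congˡ {x = constP (p m)} (monomial-value (factors m))) (R.trans
    (term-⊗ (p m) (replicate _ 0) 1# (exponents (factors m)))
    (R.trans (term-cong (zipWith ℕ._+_ (replicate _ 0) (exponents (factors m))) (*-identityʳ (p m)))
             (R.reflexive (≡.cong (term (p m)) (≡.trans (Vec.zipWith-identityˡ ℕ.+-identityˡ _) (exponents-factors m))))))

  ∑-terms-∉ : ∀ (p : Polynomial n) ms {m} → m ∉ ms → ∑ ms (λ e → term (p e) e) m ≈ 0#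
  ∑-terms-∉ p []       {m} m∉ = constP-0 m
  ∑-terms-∉ p (e ∷ ms) m∉ = trans
    (+-cong (term-≢ (p e) (m∉ ∘ here)) (∑-terms-∉ p ms (m∉ ∘ there))) (+-identityˡ 0#)

  -- As the list has no repetitions, exactly one of its terms reaches the coefficient at `m`.
  ∑-terms-∈ : ∀ (p : Polynomial n) {ms m} → Unique ms → m ∈ ms → ∑ ms (λ e → term (p e) e) m ≈ p m
  ∑-terms-∈ p {m ∷ ms} (m≢ ∷ _) (here ≡.refl) = trans
    (+-cong (term-≡ m) (∑-terms-∉ p ms (λ m∈ → All.lookup m≢ m∈ ≡.refl))) (+-identityʳ _)
    where
    term-≡ : ∀ m → term (p m) m m ≈ p m
    term-≡ m with Vec.≡-dec ℕ._≟_ m m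
    ... | yes _  = refl
    ... | no m≢m = contradiction ≡.refl m≢m
  ∑-terms-∈ p {e ∷ ms} (e≢ ∷ un) (there m∈) = trans
    (+-cong (term-≢ (p e) (λ m≡e → All.lookup e≢ m∈ (≡.sym m≡e))) (∑-terms-∈ p un m∈)) (+-identityˡ _)

  ∑-box : ∀ x (p : Polynomial n) → Supported x p → ∑ (box x) (λ e → term (p e) e) ≋ p
  ∑-box x p supp m with lookup m ⊑? x
  ... | yes m⊑x = ∑-terms-∈ p (box-unique x) (∈-box x m m⊑x)
  ... | no  m⋢x with (i , m≰x) ← Fin.¬∀⟶∃¬ n _ (λ i → lookup m i ℕ.≤? x i) m⋢x =
    trans (∑-terms-∉ p (box x) (λ m∈ → m≰x (box-⊑ x m∈ i))) (sym (supp m i (ℕ.≰⇒> m≰x)))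

  -- Every monomial in the box is listed, even with coefficient 0, since equality in a Heyting field
  -- is not decidable. The additional factor in `1 + total x` is the coefficient; all atoms are
  -- leaves, of size 0.
  bruteForce : ∀ x (p : Polynomial n) → Supported x p → SumOfProducts x p (2 ℕ.^ total x) (1 ℕ.+ total x) 1
  bruteForce x p supp = record
    { terms   = map (monomial p) (box x)
    ; correct = R.trans (R.reflexive (∑-map (box x)))
                        (R.trans (∑-cong {xs = box x} (λ {m} _ → ∏-monomial p m)) (∑-box x p supp))
    ; bounded = All.map⁺ (All.tabulate λ {m} m∈ →
        (λ i → ℕ.≤-trans (ℕ.≤-reflexive (degree-monomial m i)) (box-⊑ x m∈ i)) ,
        s≤s (ℕ.≤-trans (ℕ.≤-reflexive (≡.trans (List.length-map _ (factors m)) (length-factors m)))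
                       (total-mono (box-⊑ x m∈))) ,
        s≤s z≤n ∷ All.map⁺ (All.tabulate (λ _ → s≤s z≤n)))
    ; few     = ℕ.≤-trans (ℕ.≤-reflexive (List.length-map (monomial p) (box x))) (length-box x)
    }
    where
    degree-monomial : ∀ m i → totalDegree (monomial p m) i ≡ lookup m i
    degree-monomial m i = ≡.trans (≡.cong sumℕ (≡.sym (List.map-∘ (factors m)))) (sum-factors m i)

-- Degree bounds for values and quotients

module Supports (F : HeytingField a ℓ₁ ℓ₂) (n : ℕ) where

  open Polynomials F
  private module R = CommutativeSemiring (polynomials n)
  open ListSums (polynomials n)
  open Programs (polynomials n) Supported

  supported-mono : ∀ {x y p} → x ⊑ y → Supported {n} x p → Supported y p
  supported-mono x⊑y supp m i y<m = supp m i (ℕ.≤-<-trans (x⊑y i) y<m)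

  supported-≋ : ∀ {x p q} → p ≋ q → Supported {n} x p → Supported x q
  supported-≋ p≋q supp m i x<m = HF.trans (HF.sym (p≋q m)) (supp m i x<m)
    where module HF = HeytingField F

  supported-∑ : ∀ {x} {X : Set} (xs : List X) {g} → (∀ {e} → e ∈ xs → Supported {n} x (g e)) → Supported x (∑ xs g)
  supported-∑ {x} []           supp = supported-0 x
  supported-∑ {x} (e ∷ xs) {g} supp =
    supported-⊕ {p = g e} {∑ xs g} (supp (here ≡.refl)) (supported-∑ xs {g} (supp ∘ there))

  supported-1 : ∀ x → Supported {n} x (constP (HeytingField.1# F))
  supported-1 x = supported-term _ x (replicate n 0)
    (λ i → ℕ.≤-trans (ℕ.≤-reflexive (Vec.lookup-replicate i 0)) z≤n)

  supported-value : ∀ (P : Program N) u → Supported (bound P u) (value P u)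
  supported-value (leaf P r x _ supp) zero    = supp
  supported-value (leaf P _ _ _ _)    (suc u) = supported-value P u
  supported-value (gate P es _)       (suc u) = supported-value P u
  supported-value (gate P es _)       zero    = supported-∑ es λ {(c , h)} e∈es →
    supported-mono (λ i → ∈⇒≤maximum (λ (c , h) → bound P c i ℕ.+ bound P h i) e∈es)
      (supported-⊗ {p = value P c} {value P h} (supported-value P c) (supported-value P h))

  -- The light factors collected on the way from `u` to `v` share out the drop between the two
  -- bounds. A summand whose heavy child does not dominate `v` is 0, so truncation in its bound does
  -- no harm.
  supported-paths : ∀ (P : Program N) u v → bound P v ⊑ bound P u →
                    Supported (λ i → bound P u i ∸ bound P v i) (paths P u v)
  supported-paths (leaf P _ _ _ _) zero    zero    _   = supported-1 _
  supported-paths (leaf P _ _ _ _) zero    (suc v) _   = supported-0 _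
  supported-paths (leaf P _ _ _ _) (suc u) zero    _   = supported-0 _
  supported-paths (leaf P _ _ _ _) (suc u) (suc v) v⊑u = supported-paths P u v v⊑u
  supported-paths (gate P _ _)     zero    zero    _   = supported-1 _
  supported-paths (gate P _ _)     (suc u) zero    _   = supported-0 _
  supported-paths (gate P _ _)     (suc u) (suc v) v⊑u = supported-paths P u v v⊑u
  supported-paths (gate P es ord)  zero    (suc v) _   = supported-∑ es λ {(c , h)} e∈es → each c h e∈es
    where
    each : ∀ c h → (c , h) ∈ es →
           Supported (λ i → bound (gate P es ord) zero i ∸ bound P v i) (value P c ⊗ paths P h v)
    each c h e∈es with bound P v ⊑? bound P h
    ... | yes v⊑h = supported-mono
      (λ i → ℕ.≤-trans (ℕ.≤-reflexive (≡.sym (ℕ.+-∸-assoc (bound P c i) (v⊑h i))))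
                       (ℕ.∸-monoˡ-≤ (bound P v i) (∈⇒≤maximum (λ (c , h) → bound P c i ℕ.+ bound P h i) e∈es)))
      (supported-⊗ {p = value P c} {paths P h v} (supported-value P c) (supported-paths P h v v⊑h))
    ... | no  v⋢h = supported-≋ (R.sym (R.trans (R.*-congˡ {x = value P c} (paths-≈0 P h v v⋢h)) (R.zeroʳ (value P c))))
                                (supported-0 _)

  supported-valueTo : ∀ (P : Program N) u o → boundOf P o ⊑ bound P u →
                      Supported (λ i → bound P u i ∸ boundOf P o i) (valueTo P u o)
  supported-valueTo P u nothing  _   = supported-value P u
  supported-valueTo P u (just v) v⊑u = supported-paths P u v v⊑u

-- Translation of circuits into programs

total-unit : ∀ {n} (j : Fin n) → total (unit j) ≤ 1
total-unit {suc n} zero    = ℕ.≤-reflexive (≡.cong suc (sum-replicate-zero n))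
total-unit {suc n} (suc j) = total-unit j

module Translate (F : HeytingField a ℓ₁ ℓ₂) (n : ℕ) where

  open Polynomials F
  open Supports F n
  open HeytingField F using (Carrier; 0#; 1#)
  private module R = CommutativeSemiring (polynomials n)
  open ListSums (polynomials n)
  open Programs (polynomials n) Supported

  private
    length-arcs : ∀ (P : Program M) es ord → length (arcs (gate P es ord)) ≡ length (arcs P) ℕ.+ length es
    length-arcs P es ord = ≡.trans (List.length-++ (map first es))
      (≡.trans (≡.cong₂ ℕ._+_ (List.length-map first es) (List.length-map later (arcs P)))
               (ℕ.+-comm (length es) _))

  record Product (P : Program M) (us : List (Fin M)) : Set (a Level.⊔ ℓ₁ Level.⊔ ℓ₂) where
    field
      {vertices} : ℕ
      program    : Program vertices
      embed      : Fin M → Fin vertices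
      value≡     : ∀ u → value program (embed u) ≡ value P u
      bound≡     : ∀ u i → bound program (embed u) i ≡ bound P u i
      root       : Fin vertices
      root-value : value program root ≋ ∏ us (value P)
      root-bound : ∀ i → bound program root i ≡ foldr ℕ._+_ 0 (map (λ u → bound P u i) us)
      arcs≡      : length (arcs program) ≡ length (arcs P) ℕ.+ length us

  oriented : ∀ {M} (P : Program M) u v → Σ (Fin M × Fin M) λ (c , h) →
             weight P c ≤ weight P h × value P c ⊗ value P h ≋ value P u ⊗ value P v ×
             (∀ i → bound P c i ℕ.+ bound P h i ≡ bound P u i ℕ.+ bound P v i)
  oriented P u v with ℕ.≤-total (weight P u) (weight P v)
  ... | inj₁ u≤v = (u , v) , u≤v , R.refl , λ i → ≡.refl
  ... | inj₂ v≤u = (v , u) , v≤u , R.*-comm (value P v) (value P u) , λ i → ℕ.+-comm (bound P v i) _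

  module _ (P : Program M) (one : Fin M) (one-value : value P one ≋ constP 1#) (one-bound : ∀ i → bound P one i ≡ 0) where

    -- Starting the chain of binary products at the constant 1 yields one arc per factor, so the
    -- number of arcs agrees with the fan-in.
    product : ∀ us → Product P us
    product []       = record
      { program    = P
      ; embed      = λ u → u
      ; value≡     = λ _ → ≡.refl
      ; bound≡     = λ _ _ → ≡.refl
      ; root       = one
      ; root-value = one-value
      ; root-bound = one-bound
      ; arcs≡      = ≡.sym (ℕ.+-identityʳ _)
      }
    product (u ∷ us) with oriented Q.program (Q.embed u) Q.root
      where module Q = Product (product us)
    ... | (c , h) , c≤h , value≋ , bound≡ = record
      { program    = gate Q.program ((c , h) ∷ []) (c≤h ∷ [])
      ; embed      = suc ∘ Q.embed
      ; value≡     = Q.value≡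
      ; bound≡     = Q.bound≡
      ; root       = zero
      ; root-value = R.trans (R.+-identityʳ _) (R.trans value≋
                       (R.*-cong (R.reflexive (Q.value≡ u)) Q.root-value))
      ; root-bound = λ i → ≡.trans (ℕ.⊔-identityʳ _) (≡.trans (bound≡ i)
                       (≡.cong₂ ℕ._+_ (Q.bound≡ u i) (Q.root-bound i)))
      ; arcs≡      = ≡.trans (length-arcs Q.program _ (c≤h ∷ []))
                       (≡.trans (≡.cong (ℕ._+ 1) Q.arcs≡)
                       (≡.trans (ℕ.+-assoc (length (arcs P)) _ 1)
                                (≡.cong (length (arcs P) ℕ.+_) (ℕ.+-comm (length us) 1))))
      }
      where module Q = Product (product us)

  record Translation (C : Dag Carrier n N) : Set (a Level.⊔ ℓ₁ Level.⊔ ℓ₂) where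
    field
      {vertices} : ℕ
      program   : Program vertices
      one       : Fin vertices
      one-value : value program one ≋ constP 1#
      one-bound : ∀ i → bound program one i ≡ 0
      embed     : Fin N → Fin vertices
      value≋    : ∀ u → value program (embed u) ≋ polynomialAt F C u
      bound≡    : ∀ u i → bound program (embed u) i ≡ Var C u i
      arcs≡     : length (arcs program) ≡ edges C

  supported-const : ∀ c → Supported {n} (λ _ → 0) (constP c)
  supported-const c = supported-term c (λ _ → 0) (replicate n 0) (λ i → ℕ.≤-reflexive (Vec.lookup-replicate i 0))

  supported-var : ∀ j → Supported {n} (unit j) (varP j)
  supported-var j = supported-term 1# (unit j) (tabulate (unit j)) (λ i → ℕ.≤-reflexive (Vec.lookup∘tabulate (unit j) i))

  total-0 : total {n} (λ _ → 0) ≡ 0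
  total-0 = sum-replicate-zero n

  private
    addLeaf : ∀ {C : Dag Carrier n N} (T : Translation C) g r x ≤1 supp →
              r ≋ polynomialAt F (C ▷ g) zero → (∀ i → x i ≡ Var (C ▷ g) zero i) → edges (C ▷ g) ≡ edges C →
              Translation (C ▷ g)
    addLeaf T g r x ≤1 supp r≋ x≡ e≡ = record
      { program   = leaf program r x ≤1 supp
      ; one       = suc one
      ; one-value = one-value
      ; one-bound = one-bound
      ; embed     = λ { zero → zero ; (suc u) → suc (embed u) }
      ; value≋    = λ { zero → r≋ ; (suc u) → value≋ u }
      ; bound≡    = λ { zero → x≡ ; (suc u) → bound≡ u }
      ; arcs≡     = ≡.trans (List.length-map later (arcs program)) (≡.trans arcs≡ (≡.sym e≡))
      }
      where open Translation T

  translate : ∀ (C : Dag Carrier n N) → Translation C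
  translate []            = record
    { program   = leaf [] (constP 1#) (λ _ → 0) (ℕ.≤-trans (ℕ.≤-reflexive total-0) z≤n) (supported-const 1#)
    ; one       = zero
    ; one-value = R.refl
    ; one-bound = λ _ → ≡.refl
    ; embed     = λ ()
    ; value≋    = λ ()
    ; bound≡    = λ ()
    ; arcs≡     = ≡.refl
    }
  translate (C ▷ var j)   = addLeaf (translate C) (var j) (varP j) (unit j) (total-unit j) (supported-var j)
    R.refl (λ _ → ≡.refl) (ℕ.+-identityʳ _)
  translate (C ▷ const c) = addLeaf (translate C) (const c) (constP c) (λ _ → 0)
    (ℕ.≤-trans (ℕ.≤-reflexive total-0) z≤n) (supported-const c) R.refl (λ _ → ≡.refl) (ℕ.+-identityʳ _)
  translate (C ▷ sum us⁺) = record
    { program   = gate program es ord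
    ; one       = suc one
    ; one-value = one-value
    ; one-bound = one-bound
    ; embed     = λ { zero → zero ; (suc u) → suc (embed u) }
    ; value≋    = λ { zero → sum-value ; (suc u) → value≋ u }
    ; bound≡    = λ { zero → sum-bound ; (suc u) → bound≡ u }
    ; arcs≡     = ≡.trans (length-arcs program es ord) (≡.cong₂ ℕ._+_ arcs≡ (List.length-map _ us))
    }
    where
    open Translation (translate C)
    us = List⁺.toList us⁺
    es = map (λ u → one , embed u) us
    ord : All (λ (c , h) → weight program c ≤ weight program h) es
    ord = All.map⁺ (All.tabulate λ _ → ℕ.≤-trans (ℕ.≤-reflexive (≡.trans (sum-cong-≗ one-bound) total-0)) z≤n)

    sum-value : ∑ es (λ (c , h) → value program c ⊗ value program h) ≋ ∑ us (polynomialAt F C)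
    sum-value = R.trans (R.reflexive (∑-map us)) (∑-cong {xs = us} λ {u} _ →
      R.trans (R.*-cong {u = value program (embed u)} one-value (value≋ u)) (R.*-identityˡ _))

    sum-bound : ∀ i → maximum (λ (c , h) → bound program c i ℕ.+ bound program h i) es ≡ maximum (λ u → Var C u i) us
    sum-bound i = ≡.cong (foldr _⊔_ 0) (≡.trans (≡.sym (List.map-∘ us))
      (List.map-cong (λ u → ≡.cong₂ ℕ._+_ (one-bound i) (bound≡ u i)) us))
  translate (C ▷ prod us⁺) = record
    { program   = Q.program
    ; one       = Q.embed one
    ; one-value = R.trans (R.reflexive (Q.value≡ one)) one-value
    ; one-bound = λ i → ≡.trans (Q.bound≡ one i) (one-bound i)
    ; embed     = λ { zero → Q.root ; (suc u) → Q.embed (embed u) }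
    ; value≋    = λ { zero → prod-value ; (suc u) → R.trans (R.reflexive (Q.value≡ (embed u))) (value≋ u) }
    ; bound≡    = λ { zero → prod-bound ; (suc u) i → ≡.trans (Q.bound≡ (embed u) i) (bound≡ u i) }
    ; arcs≡     = ≡.trans Q.arcs≡ (≡.cong₂ ℕ._+_ arcs≡ (List.length-map embed us))
    }
    where
    open Translation (translate C)
    us = List⁺.toList us⁺
    module Q = Product (product program one one-value one-bound (map embed us))

    ∏-values : ∀ us → ∏ (map embed us) (value program) ≋ ∏ us (polynomialAt F C)
    ∏-values []       = R.refl
    ∏-values (u ∷ us) = R.*-cong (value≋ u) (∏-values us)

    prod-value : value Q.program Q.root ≋ ∏ us (polynomialAt F C)
    prod-value = R.trans Q.root-value (∏-values us)

    prod-bound : ∀ i → bound Q.program Q.root i ≡ foldr ℕ._+_ 0 (map (λ u → Var C u i) us)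
    prod-bound i = ≡.trans (Q.root-bound i) (≡.cong (foldr ℕ._+_ 0) (≡.trans (≡.sym (List.map-∘ us))
      (List.map-cong (λ u → bound≡ u i) us)))

odd-suc : ∀ l → l ℕ.% 2 ≡ 0 → suc l ℕ.% 2 ≡ 1
odd-suc zero          _    = ≡.refl
odd-suc (suc (suc l)) even = odd-suc l even

-- Numerical estimates

module Numerics where

  open import Data.Nat.Base using (_+_; _*_; _^_)
  open ℕ.≤-Reasoning

  linear≤exponential : ∀ c d b n → c + d ≤ b → 2 ≤ b → 1 ≤ n → c + d * n ≤ b ^ n
  linear≤exponential c d b (suc zero) c+d≤b _ _ = begin
    c + d * 1 ≡⟨ ≡.cong (c +_) (ℕ.*-identityʳ d) ⟩
    c + d     ≤⟨ c+d≤b ⟩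
    b         ≡⟨ ℕ.*-identityʳ b ⟨
    b ^ 1     ∎
  linear≤exponential c d b (suc (suc n)) c+d≤b 2≤b _
    with ih ← linear≤exponential c d b (suc n) c+d≤b 2≤b (s≤s z≤n) = begin
    c + d * (2 + n)            ≡⟨ ≡.cong (c +_) (≡.trans (ℕ.*-suc d (suc n)) (ℕ.+-comm d _)) ⟩
    c + (d * suc n + d)        ≡⟨ ℕ.+-assoc c _ d ⟨
    c + d * suc n + d          ≤⟨ ℕ.+-mono-≤ ih (ℕ.≤-trans (ℕ.≤-trans (ℕ.m≤m*n d (suc n)) (ℕ.m≤n+m _ c)) ih) ⟩
    b ^ suc n + b ^ suc n      ≡⟨ ≡.cong (b ^ suc n +_) (ℕ.+-identityʳ _) ⟨
    2 * b ^ suc n              ≤⟨ ℕ.*-monoˡ-≤ (b ^ suc n) 2≤b ⟩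
    b ^ (2 + n)                ∎

  -- The left side is the size that `layer` assigns to `2 ^ w` products of `1 + w` leaves. The 4 is
  -- 1 + 3, from `5 + τ ≤ 8 ^ τ`.
  bruteForce-size : ∀ w τ → w ≤ τ → 1 ≤ τ → 2 + 2 ^ w * (2 + (1 + w) * 1) ≤ 2 ^ (4 * τ)
  bruteForce-size w τ w≤τ 1≤τ = begin
    2 + 2 ^ w * (2 + (1 + w) * 1)
      ≤⟨ ℕ.+-mono-≤ (ℕ.*-monoʳ-≤ 2 (ℕ.m^n>0 2 τ))
                    (ℕ.*-mono-≤ (ℕ.^-monoʳ-≤ 2 w≤τ) (ℕ.+-monoʳ-≤ 2 (ℕ.*-monoˡ-≤ 1 (s≤s w≤τ)))) ⟩
    2 * 2 ^ τ + 2 ^ τ * (2 + (1 + τ) * 1)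
      ≡⟨ solve 2 (λ x t → con 2 :* x :+ x :* (con 2 :+ (con 1 :+ t) :* con 1) := x :* (con 5 :+ con 1 :* t)) ≡.refl (2 ^ τ) τ ⟩
    2 ^ τ * (5 + 1 * τ)
      ≤⟨ ℕ.*-monoʳ-≤ (2 ^ τ) (linear≤exponential 5 1 8 τ (ℕ.m≤m+n 6 2) (ℕ.m≤m+n 2 6) 1≤τ) ⟩
    2 ^ τ * (2 ^ 3) ^ τ
      ≡⟨ ≡.cong (2 ^ τ *_) (ℕ.^-*-assoc 2 3 τ) ⟩
    2 ^ τ * 2 ^ (3 * τ)
      ≡⟨ ℕ.^-distribˡ-+-* 2 τ (3 * τ) ⟨
    2 ^ (4 * τ) ∎
    where open +-*-Solver

  -- The left side is the size of a ΣΠ layer after `2 * R` cuts. The number of factors is absorbed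
  -- by `5 + 4 * R ≤ 16 ^ R ≤ s ^ (4 * R)`.
  level-size : ∀ s R Y → 2 ≤ s → 1 ≤ R → 1 ≤ Y →
               2 + s ^ (2 * R) * (2 + (1 + 2 * (2 * R)) * Y) ≤ s ^ (8 * R) * Y
  level-size s@(suc _) R Y 2≤s 1≤R 1≤Y = begin
    2 + S * (2 + (1 + 2 * (2 * R)) * Y)
      ≤⟨ ℕ.+-mono-≤ (ℕ.*-monoʳ-≤ 2 (ℕ.*-mono-≤ (ℕ.m^n>0 s (2 * R)) 1≤Y))
                    (ℕ.*-monoʳ-≤ S (ℕ.+-monoˡ-≤ ((1 + 2 * (2 * R)) * Y) (ℕ.*-monoʳ-≤ 2 1≤Y))) ⟩
    2 * (S * Y) + S * (2 * Y + (1 + 2 * (2 * R)) * Y)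
      ≡⟨ solve 3 (λ x y r → con 2 :* (x :* y) :+ x :* (con 2 :* y :+ (con 1 :+ con 2 :* (con 2 :* r)) :* y)
                   := x :* (con 5 :+ con 4 :* r) :* y) ≡.refl S Y R ⟩
    S * (5 + 4 * R) * Y
      ≤⟨ ℕ.*-monoˡ-≤ Y (ℕ.*-monoʳ-≤ S (linear≤exponential 5 4 16 R (ℕ.m≤m+n 9 7) (ℕ.m≤m+n 2 14) 1≤R)) ⟩
    S * 16 ^ R * Y
      ≡⟨ ≡.cong (λ x → S * x * Y) (ℕ.^-*-assoc 2 4 R) ⟩
    S * 2 ^ (4 * R) * Y
      ≤⟨ ℕ.*-monoˡ-≤ Y (ℕ.*-monoʳ-≤ S (ℕ.^-monoˡ-≤ (4 * R) 2≤s)) ⟩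
    S * s ^ (4 * R) * Y
      ≡⟨ ≡.cong (_* Y) (ℕ.^-distribˡ-+-* s (2 * R) (4 * R)) ⟨
    s ^ (2 * R + 4 * R) * Y
      ≡⟨ ≡.cong (λ x → s ^ x * Y) (ℕ.*-distribʳ-+ R 2 4) ⟨
    s ^ (6 * R) * Y
      -- Padding 6 to 8, the exponent of the bottom layer, gives all layers the same growth factor.
      ≤⟨ ℕ.*-monoˡ-≤ Y (ℕ.^-monoʳ-≤ s (ℕ.*-monoˡ-≤ R (ℕ.m≤m+n 6 2))) ⟩
    s ^ (8 * R) * Y ∎
    where
    open +-*-Solver
    S = s ^ (2 * R)

  -- Rounds a real parameter up: `suc r` is large enough, and the failure at `r` is the lower bound
  -- that the size estimates need.
  threshold : ∀ {p} {P : Pred ℕ p} → Decidable P → ∀ b → P b → ¬ P 0 → Σ ℕ λ r → ¬ P r × P (suc r)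
  threshold P? zero    pb ¬p0 = contradiction pb ¬p0
  threshold P? (suc b) pb ¬p0 with P? b
  ... | yes p = threshold P? b p ¬p0
  ... | no ¬p = b , ¬p , pb

  ^-distribʳ-* : ∀ m n o → (m * n) ^ o ≡ m ^ o * n ^ o
  ^-distribʳ-* m n zero    = ≡.refl
  ^-distribʳ-* m n (suc o) = ≡.trans (≡.cong (m * n *_) (^-distribʳ-* m n o)) (ℕ.[m*n]*[o*p]≡[m*o]*[n*p] m n (m ^ o) (n ^ o))

  ^-cancelˡ-≤ : ∀ n {m o} → 1 ≤ n → m ^ n ≤ o ^ n → m ≤ o
  ^-cancelˡ-≤ n@(suc _) _ m^n≤o^n = ℕ.≮⇒≥ λ o<m → ℕ.<⇒≱ (ℕ.^-monoˡ-< n o<m) m^n≤o^n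

  2^-cancel-≤ : ∀ {m n} → 2 ^ m ≤ 2 ^ n → m ≤ n
  2^-cancel-≤ 2^m≤2^n = ℕ.≮⇒≥ λ n<m → ℕ.<⇒≱ (ℕ.^-monoʳ-< 2 (s≤s (s≤s z≤n)) n<m) 2^m≤2^n

  exponent⇒ : ∀ {Δ n k s} ℓ p q → s ≤ 2 ^ ℓ → exponent 16 Δ n k s p q → (16 * Δ * q) ^ Δ * (n * k) ≤ ℓ * p ^ Δ
  exponent⇒ {Δ} {n} {k} {s} ℓ p q s≤ e = 2^-cancel-≤ (begin
    2 ^ ((16 * Δ * q) ^ Δ * (n * k)) ≤⟨ e ⟩
    s ^ (p ^ Δ)                      ≤⟨ ℕ.^-monoˡ-≤ (p ^ Δ) s≤ ⟩
    (2 ^ ℓ) ^ (p ^ Δ)                ≡⟨ ℕ.^-*-assoc 2 ℓ (p ^ Δ) ⟩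
    2 ^ (ℓ * p ^ Δ)                  ∎)

  -- As `nk / ℓ ≤ 1` is at most its own Δ-th root, an exponent of order `nk / ℓ` is affordable:
  -- multiply the hypothesis by `X ^ δ ≤ ℓ ^ δ` and take Δ-th roots. Squares are compared because
  -- `ℓ` is rounded up and only `2 ^ ℓ ≤ s * s` holds.
  small-degree-bound : ∀ {Δ n k s m} ℓ → 1 ≤ Δ → s ≤ 2 ^ ℓ → 2 ^ ℓ ≤ s * s → n * k ≤ ℓ →
                       m ≤ 2 ^ (4 * (n * k)) → m ≤ s ^[ exponent 16 Δ n k s ]
  small-degree-bound {Δ@(suc δ)} {n} {k} {s} {m} ℓ 1≤Δ s≤ ≤s² X≤ℓ m≤ p q 1≤q e = ^-cancelˡ-≤ 2 (s≤s z≤n) (begin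
    (m ^ q) ^ 2                 ≤⟨ ℕ.^-monoˡ-≤ 2 (ℕ.^-monoˡ-≤ q m≤) ⟩
    ((2 ^ (4 * X)) ^ q) ^ 2     ≡⟨ ≡.trans (ℕ.^-*-assoc (2 ^ (4 * X)) q 2) (ℕ.^-*-assoc 2 (4 * X) (q * 2)) ⟩
    2 ^ (4 * X * (q * 2))       ≤⟨ ℕ.^-monoʳ-≤ 2 8qX≤ℓp ⟩
    2 ^ (ℓ * p)                 ≡⟨ ℕ.^-*-assoc 2 ℓ p ⟨
    (2 ^ ℓ) ^ p                 ≤⟨ ℕ.^-monoˡ-≤ p ≤s² ⟩
    (s * s) ^ p                 ≡⟨ ≡.cong (λ x → (s * x) ^ p) (ℕ.*-identityʳ s) ⟨
    (s ^ 2) ^ p                 ≡⟨ ℕ.^-*-assoc s 2 p ⟩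
    s ^ (2 * p)                 ≡⟨ ≡.cong (s ^_) (ℕ.*-comm 2 p) ⟩
    s ^ (p * 2)                 ≡⟨ ℕ.^-*-assoc s p 2 ⟨
    (s ^ p) ^ 2                 ∎)
    where
    open +-*-Solver
    X = n * k

    powers : (16 * Δ * q * X) ^ Δ ≤ (ℓ * p) ^ Δ
    powers = begin
      (16 * Δ * q * X) ^ Δ            ≡⟨ ^-distribʳ-* (16 * Δ * q) X Δ ⟩
      (16 * Δ * q) ^ Δ * (X * X ^ δ)  ≡⟨ ℕ.*-assoc ((16 * Δ * q) ^ Δ) X _ ⟨
      (16 * Δ * q) ^ Δ * X * X ^ δ    ≤⟨ ℕ.*-mono-≤ (exponent⇒ {Δ} {n} {k} {s} ℓ p q s≤ e) (ℕ.^-monoˡ-≤ δ X≤ℓ) ⟩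
      ℓ * p ^ Δ * ℓ ^ δ               ≡⟨ solve 3 (λ x y z → x :* y :* z := x :* z :* y) ≡.refl ℓ (p ^ Δ) (ℓ ^ δ) ⟩
      ℓ ^ Δ * p ^ Δ                   ≡⟨ ^-distribʳ-* ℓ p Δ ⟨
      (ℓ * p) ^ Δ                     ∎

    8qX≤ℓp : 4 * X * (q * 2) ≤ ℓ * p
    8qX≤ℓp = begin
      4 * X * (q * 2)      ≡⟨ solve 2 (λ x y → con 4 :* x :* (y :* con 2) := con 8 :* y :* x) ≡.refl X q ⟩
      8 * q * X            ≤⟨ ℕ.*-monoˡ-≤ X (ℕ.*-monoˡ-≤ q (ℕ.≤-trans (ℕ.m≤m+n 8 8) (ℕ.m≤m*n 16 Δ))) ⟩
      16 * Δ * q * X       ≤⟨ ^-cancelˡ-≤ Δ 1≤Δ powers ⟩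
      ℓ * p                ∎

  -- The construction uses the rounded-up root `suc r`, whereas `r` is what lies below
  -- `(nk / ℓ)^(1/Δ)`. From `suc r ≤ 2 * r` the constant 8 becomes 16.
  large-degree-bound : ∀ {Δ n k s m} ℓ r → 1 ≤ Δ → 1 ≤ ℓ → 2 ≤ s → s ≤ 2 ^ ℓ → 1 ≤ r → r ^ Δ * ℓ ≤ n * k →
                       m ≤ s ^ (8 * suc r * Δ) → m ≤ s ^[ exponent 16 Δ n k s ]
  large-degree-bound {Δ} {n} {k} {s@(suc _)} {m} ℓ r 1≤Δ 1≤ℓ 2≤s s≤ 1≤r r≤ m≤ p q 1≤q e = begin
    m ^ q                      ≤⟨ ℕ.^-monoˡ-≤ q m≤ ⟩
    (s ^ (8 * suc r * Δ)) ^ q  ≡⟨ ℕ.^-*-assoc s (8 * suc r * Δ) q ⟩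
    s ^ (8 * suc r * Δ * q)    ≤⟨ ℕ.^-monoʳ-≤ s (^-cancelˡ-≤ Δ 1≤Δ (ℕ.*-cancelʳ-≤ _ _ ℓ {{>-nonZero 1≤ℓ}} powers)) ⟩
    s ^ p                      ∎
    where
    open +-*-Solver
    X = n * k

    8suc≤16 : 8 * suc r * Δ * q ≤ 16 * Δ * q * r
    8suc≤16 = begin
      8 * suc r * Δ * q       ≡⟨ solve 3 (λ r d q → con 8 :* (con 1 :+ r) :* d :* q :=
                                                       con 8 :* d :* q :* (con 1 :+ r)) ≡.refl r Δ q ⟩
      8 * Δ * q * (1 + r)     ≤⟨ ℕ.*-monoʳ-≤ (8 * Δ * q) (ℕ.+-monoˡ-≤ r 1≤r) ⟩
      8 * Δ * q * (r + r)     ≡⟨ solve 3 (λ r d q → con 8 :* d :* q :* (r :+ r) := con 16 :* d :* q :* r) ≡.refl r Δ q ⟩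
      16 * Δ * q * r          ∎

    powers : (8 * suc r * Δ * q) ^ Δ * ℓ ≤ p ^ Δ * ℓ
    powers = begin
      (8 * suc r * Δ * q) ^ Δ * ℓ    ≤⟨ ℕ.*-monoˡ-≤ ℓ (ℕ.^-monoˡ-≤ Δ 8suc≤16) ⟩
      (16 * Δ * q * r) ^ Δ * ℓ       ≡⟨ ≡.cong (_* ℓ) (^-distribʳ-* (16 * Δ * q) r Δ) ⟩
      (16 * Δ * q) ^ Δ * r ^ Δ * ℓ   ≡⟨ ℕ.*-assoc ((16 * Δ * q) ^ Δ) _ _ ⟩
      (16 * Δ * q) ^ Δ * (r ^ Δ * ℓ) ≤⟨ ℕ.*-monoʳ-≤ ((16 * Δ * q) ^ Δ) r≤ ⟩
      (16 * Δ * q) ^ Δ * X           ≤⟨ exponent⇒ {Δ} {n} {k} {s} ℓ p q s≤ e ⟩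
      ℓ * p ^ Δ                      ≡⟨ ℕ.*-comm ℓ _ ⟩
      p ^ Δ * ℓ                      ∎

open Numerics

-- Assembly of the layers and choice of the parameters

total-≤ : ∀ {n} {x : Fin n → ℕ} {k} → (∀ i → x i ≤ k) → total x ≤ n ℕ.* k
total-≤ {zero}  x≤k = z≤n
total-≤ {suc n} x≤k = ℕ.+-mono-≤ (x≤k zero) (total-≤ (x≤k ∘ suc))

module Layers (F : HeytingField a ℓ₁ ℓ₂) (n Δ : ℕ) where

  open Polynomials F
  open Supports F n
  private module R = CommutativeSemiring (polynomials n)
  open ListSums (polynomials n)
  private module Fo = Formulas F n Δ
  open Fo using (Formula; ⟦_⟧; ⟦_⟧s; ⟦⟧s≡map; degreesOf≡map; sizesOf≤)
  open Programs (polynomials n) Supported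
  module Sums (l : ℕ) = SumsOfProducts (polynomials n) {Atom = Formula l} ⟦_⟧ Fo.degreeOf Fo.sizeOf
  open Sums using (SumOfProducts)

  -- A ΣΠ formula in layers l and l + 1 with inputs in layer l + 2.
  record Layer (l : ℕ) (l< : l < 2 ℕ.* Δ) (even : l ℕ.% 2 ≡ 0) (x : Fin n → ℕ) (p : Polynomial n) (Y : ℕ) :
               Set (a Level.⊔ ℓ₁) where
    field
      inputs  : List (Formula (suc l))
      degree≤ : Fo.degreeOf (Fo.sum l< even inputs) ⊑ x
      value≋  : ⟦ Fo.sum l< even inputs ⟧ ≋ p
      size<   : Fo.sizeOf (Fo.sum l< even inputs) < Y

  -- Each 2 is the edge of a gate to its constant plus one for the strict inequality, which pays for
  -- the edge from the parent.
  layer : ∀ {l} l< even {x p T L Y} → suc l < 2 ℕ.* Δ → SumOfProducts (suc (suc l)) x p T L Y →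
          Layer l l< even x p (2 ℕ.+ T ℕ.* (2 ℕ.+ L ℕ.* Y))
  layer {l} l< even {x} {p} {T} {L} {Y} sl< s = record
    { inputs  = map product (terms s)
    ; degree≤ = λ i → ℕ.≤-trans (ℕ.≤-reflexive (≡.cong (foldr _⊔_ 0) (degreesOf≡map (map product (terms s)) i)))
                                (degree-terms i (bounded s))
    ; value≋  = R.trans (R.reflexive (≡.cong (foldr _⊕_ _) (⟦⟧s≡map (map product (terms s)))))
                  (R.trans (R.reflexive (∑-map (terms s)))
                  (R.trans (∑-cong {xs = terms s} λ {as} _ → R.reflexive (≡.cong (foldr _⊗_ _) (⟦⟧s≡map as)))
                           (correct s)))
    ; size<   = s≤s (s≤s (ℕ.≤-trans (sizesOf≤ (map product (terms s)) (All.map⁺ (All.map product-size (bounded s))))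
                  (ℕ.*-monoˡ-≤ (2 ℕ.+ L ℕ.* Y)
                    (ℕ.≤-trans (ℕ.≤-reflexive (List.length-map product (terms s))) (few s)))))
    }
    where
    open Sums (suc (suc l))
    product : List (Formula (suc (suc l))) → Formula (suc l)
    product = Fo.prod sl< (odd-suc l even)

    degree-terms : ∀ i {ts} → All (λ as → totalDegree as ⊑ x × length as ≤ L × All (λ a → Fo.sizeOf a < Y) as) ts →
                   foldr _⊔_ 0 (map (λ φ → Fo.degreeOf φ i) (map product ts)) ≤ x i
    degree-terms i []                            = z≤n
    degree-terms i (_∷_ {as} (as⊑x , _) bs) = ℕ.⊔-lub
      (ℕ.≤-trans (ℕ.≤-reflexive (≡.cong sumℕ (degreesOf≡map as i))) (as⊑x i)) (degree-terms i bs)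

    product-size : ∀ {as} → totalDegree as ⊑ x × length as ≤ L × All (λ a → Fo.sizeOf a < Y) as →
                   Fo.sizeOf (product as) < 2 ℕ.+ L ℕ.* Y
    product-size {as} (_ , len , sz) = s≤s (s≤s (ℕ.≤-trans (sizesOf≤ as sz) (ℕ.*-monoˡ-≤ Y len)))

  widen : ∀ {l l< even x p Y Y′} → Y ≤ Y′ → Layer l l< even x p Y → Layer l l< even x p Y′
  widen Y≤Y′ L = record { Layer L ; size< = ℕ.<-≤-trans (Layer.size< L) Y≤Y′ }

  bruteForceLayer : ∀ {l} l< even → suc l < 2 ℕ.* Δ → ∀ x p τ → Supported x p → total x ≤ τ → 1 ≤ τ →
                    Layer l l< even x p (2 ℕ.^ (4 ℕ.* τ))
  bruteForceLayer {l} l< even sl< x p τ supp x≤τ 1≤τ =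
    widen (bruteForce-size (total x) τ x≤τ 1≤τ) (layer l< even sl< (bruteForce x p supp))
    where open BruteForce F n Δ (suc (suc l))

  module _ {N} (P : Program N) (s ℓ r : ℕ) (arcs≡s : length (arcs P) ≡ s)
           (2≤s : 2 ≤ s) (1≤ℓ : 1 ≤ ℓ) (2^ℓ≤s² : 2 ℕ.^ ℓ ≤ s ℕ.* s) (1≤r : 1 ≤ r) where

    private
      instance
        s≢0 = >-nonZero (ℕ.≤-trans (s≤s z≤n) 2≤s)
        r≢0 = >-nonZero 1≤r

    τ : ℕ → ℕ
    τ j = r ℕ.^ suc j ℕ.* ℓ

    1≤τ : ∀ j → 1 ≤ τ j
    1≤τ j = ℕ.*-mono-≤ (ℕ.m^n>0 r (suc j)) 1≤ℓ

    -- The 8 comes from the bottom layer: `2 ^ (4 * τ 0)` with `2 ^ ℓ ≤ s * s`.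
    budget : ℕ → ℕ
    budget j = s ℕ.^ (8 ℕ.* r ℕ.* suc j)

    budget-zero : 2 ℕ.^ (4 ℕ.* τ 0) ≤ budget 0
    budget-zero = begin
      2 ℕ.^ (4 ℕ.* (r ℕ.* 1 ℕ.* ℓ)) ≡⟨ ≡.cong (2 ℕ.^_)
                                         (solve 2 (λ r ℓ → con 4 :* (r :* con 1 :* ℓ) := ℓ :* (con 4 :* r)) ≡.refl r ℓ) ⟩
      2 ℕ.^ (ℓ ℕ.* (4 ℕ.* r))       ≡⟨ ℕ.^-*-assoc 2 ℓ (4 ℕ.* r) ⟨
      (2 ℕ.^ ℓ) ℕ.^ (4 ℕ.* r)       ≤⟨ ℕ.^-monoˡ-≤ (4 ℕ.* r) 2^ℓ≤s² ⟩
      (s ℕ.* s) ℕ.^ (4 ℕ.* r)       ≡⟨ ≡.cong (λ x → (s ℕ.* x) ℕ.^ (4 ℕ.* r)) (ℕ.*-identityʳ s) ⟨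
      (s ℕ.^ 2) ℕ.^ (4 ℕ.* r)       ≡⟨ ℕ.^-*-assoc s 2 (4 ℕ.* r) ⟩
      s ℕ.^ (2 ℕ.* (4 ℕ.* r))       ≡⟨ ≡.cong (s ℕ.^_)
                                         (solve 1 (λ r → con 2 :* (con 4 :* r) := con 8 :* r :* con 1) ≡.refl r) ⟩
      budget 0                      ∎
      where
      open ℕ.≤-Reasoning
      open +-*-Solver

    budget-suc : ∀ j → 2 ℕ.+ s ℕ.^ (2 ℕ.* r) ℕ.* (2 ℕ.+ (1 ℕ.+ 2 ℕ.* (2 ℕ.* r)) ℕ.* budget j) ≤ budget (suc j)
    budget-suc j = ℕ.≤-trans (level-size s r (budget j) 2≤s 1≤r (ℕ.m^n>0 s (8 ℕ.* r ℕ.* suc j)))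
      (ℕ.≤-reflexive (≡.trans (≡.sym (ℕ.^-distribˡ-+-* s (8 ℕ.* r) _)) (≡.cong (s ℕ.^_) (≡.sym (ℕ.*-suc (8 ℕ.* r) (suc j))))))

    -- Items of one layer are atoms of the layer above, so all vertices and targets are treated at
    -- once. The `suc j` remaining ΣΠ layers are numbered from `l` to `l + 2j + 1`, which the
    -- hypothesis on `l` keeps below `2 * Δ`.
    layers : ∀ j {l} l< even → l ℕ.+ 2 ℕ.* suc j ≤ 2 ℕ.* Δ → ∀ u o → boundOf P o ⊑ bound P u →
             weight P u ≤ weightOf P o ℕ.+ τ j →
             Layer l l< even (λ i → bound P u i ∸ boundOf P o i) (valueTo P u o) (budget j)
    layers zero {l} l< even l+2≤ u o o⊑u u≤ = widen budget-zero
      (bruteForceLayer l< even (ℕ.≤-trans (ℕ.≤-reflexive (ℕ.+-comm 2 l)) l+2≤) _ (valueTo P u o) (τ 0)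
        (supported-valueTo P u o o⊑u)
        (ℕ.+-cancelʳ-≤ (weightOf P o) _ _
          (ℕ.≤-trans (ℕ.≤-reflexive (total-∸ o⊑u)) (ℕ.≤-trans u≤ (ℕ.≤-reflexive (ℕ.+-comm (weightOf P o) _)))))
        (1≤τ 0))
    layers (suc j) {l} l< even l+2≤ u o o⊑u u≤ = widen (budget-suc j)
      -- `τ (suc j)` is `r` times `τ j`, so `2 * r` cuts bring every factor down to the weight of
      -- the next layer.
      (layer l< even (ℕ.≤-trans (s≤s (ℕ.n≤1+n (suc l))) 2+l<) (expand r u o o⊑u
        (ℕ.≤-trans u≤ (ℕ.≤-reflexive (≡.trans (ℕ.+-comm (weightOf P o) _)
          (≡.cong (ℕ._+ weightOf P o) (ℕ.*-assoc r (r ℕ.^ suc j) ℓ)))))))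
      where
      shifted : suc (suc l) ℕ.+ 2 ℕ.* suc j ≤ 2 ℕ.* Δ
      shifted = ℕ.≤-trans (ℕ.≤-reflexive (solve 2 (λ l j → con 2 :+ l :+ con 2 :* (con 1 :+ j) :=
                                                            l :+ con 2 :* (con 2 :+ j)) ≡.refl l j)) l+2≤
        where open +-*-Solver

      2+l< : suc (suc l) < 2 ℕ.* Δ
      2+l< = ℕ.<-≤-trans (ℕ.m<m+n (suc (suc l)) (s≤s z≤n)) shifted

      open Expansion (polynomials n) Supported {Atom = Formula (suc (suc l))} ⟦_⟧ Fo.degreeOf Fo.sizeOf

      small : Small P (τ j) (budget j)
      small u o o⊑u u≤ = Fo.sum 2+l< even (Layer.inputs L) , Layer.degree≤ L , Layer.size< L , Layer.value≋ L
        where L = layers j 2+l< even shifted u o o⊑u u≤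

      open FromSmall P s (τ j) (budget j) (1≤τ j) (ℕ.≤-trans (s≤s z≤n) 2≤s) (ℕ.≤-reflexive arcs≡s) small

  layer⇒circuit : ∀ {k l< even x p Y} → (∀ i → x i ≤ k) → Layer 0 l< even x p Y →
    Σ (Circuit (HeytingField.Carrier F) n) λ C → MultiIc k C × ProductDepth Δ C × polynomial F C ≋ p × size C ≤ Y
  layer⇒circuit {k} {l<} {even} x≤k L
    with (C , multi , depth , poly , size≡) ←
           Fo.Compile.circuit k (Layer.inputs L) l< even (λ i → ℕ.≤-trans (Layer.degree≤ L i) (x≤k i)) =
    C , multi , depth , R.trans poly (Layer.value≋ L) ,
    ℕ.≤-trans (ℕ.≤-reflexive size≡) (ℕ.<⇒≤ (Layer.size< L))

open Defs using (_≋_)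

depthReduction : ∀ (F : HeytingField a ℓ₁ ℓ₂) (n k Δ s : ℕ) → 1 ≤ n → 1 ≤ k → 1 ≤ Δ → 2 ≤ s →
  (C : Circuit (HeytingField.Carrier F) n) → MultiIc k C → size C ≡ s →
  Σ (Circuit (HeytingField.Carrier F) n) λ C′ →
    MultiIc k C′ × ProductDepth Δ C′ × _≋_ F (polynomial F C′) (polynomial F C) × size C′ ≤ s ^[ exponent 16 Δ n k s ]
depthReduction F n k Δ@(suc δ) s 1≤n 1≤k 1≤Δ 2≤s C multi size≡s
  -- `suc m` is log₂ s rounded up; `2 ^ m < s` and `2 ≤ s` give `2 ^ suc m ≤ s * s`.
  with (m , s≰2^m , s≤2^1+m) ← threshold (λ m → s ℕ.≤? 2 ℕ.^ m) s (ℕ.<⇒≤ (n<2^n s)) (ℕ.<⇒≱ 2≤s)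
  -- `suc r` is the Δ-th root of `nk / ℓ` rounded up. The search starts at `nk`, which is large
  -- enough because `nk ≤ (nk)^Δ`.
  with (r , nk≰ , nk≤) ← threshold (λ r → n ℕ.* k ℕ.≤? r ℕ.^ Δ ℕ.* suc m) (n ℕ.* k)
         (ℕ.≤-trans (ℕ.m≤m*n (n ℕ.* k) ((n ℕ.* k) ℕ.^ δ) {{ℕ.m^n≢0 (n ℕ.* k) δ {{>-nonZero (ℕ.*-mono-≤ 1≤n 1≤k)}}}})
                    (ℕ.m≤m*n _ (suc m)))
         (ℕ.<⇒≱ (ℕ.*-mono-≤ 1≤n 1≤k)) =
  reduce r nk≰ nk≤
  where
  open Polynomials F using (polynomials; Supported)
  open Layers F n Δ
  open Supports F n
  open Programs (polynomials n) Supported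
  open Translate F n
  open Translation (translate (dag C))
    using (program; embed; arcs≡; value≋; bound≡)
  module R = CommutativeSemiring (polynomials n)

  ℓ = suc m
  u = embed (output C)

  2^ℓ≤s² : 2 ℕ.^ ℓ ≤ s ℕ.* s
  2^ℓ≤s² = ℕ.*-mono-≤ 2≤s (ℕ.<⇒≤ (ℕ.≰⇒> s≰2^m))

  bound≤k : ∀ i → bound program u i ≤ k
  bound≤k i = ℕ.≤-trans (ℕ.≤-reflexive (bound≡ (output C) i)) (multi (output C) i)

  0<2Δ : 0 < 2 ℕ.* Δ
  0<2Δ = s≤s z≤n

  1<2Δ : 1 < 2 ℕ.* Δ
  1<2Δ = ℕ.*-monoʳ-≤ 2 1≤Δ

  reduce : ∀ r → ¬ n ℕ.* k ≤ r ℕ.^ Δ ℕ.* ℓ → n ℕ.* k ≤ suc r ℕ.^ Δ ℕ.* ℓ → _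
  -- Here `nk ≤ 1 ^ Δ * ℓ`. The case is separate since `suc r ≤ 2 * r` fails at 0.
  reduce zero nk≰ nk≤
    with (C′ , multi′ , depth , poly , size′) ← layer⇒circuit bound≤k
           (bruteForceLayer 0<2Δ ≡.refl 1<2Δ (bound program u) (value program u) (n ℕ.* k)
             (supported-value program u) (total-≤ bound≤k) (ℕ.*-mono-≤ 1≤n 1≤k)) =
    C′ , multi′ , depth , R.trans poly (value≋ (output C)) ,
    small-degree-bound {n = n} {k} ℓ 1≤Δ s≤2^1+m 2^ℓ≤s²
      (ℕ.≤-trans nk≤ (ℕ.≤-reflexive (≡.trans (≡.cong (ℕ._* ℓ) (ℕ.^-zeroˡ Δ)) (ℕ.*-identityˡ ℓ)))) size′
  reduce r@(suc _) nk≰ nk≤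
    with (C′ , multi′ , depth , poly , size′) ← layer⇒circuit bound≤k
           (layers program s ℓ (suc r) (≡.trans arcs≡ size≡s) 2≤s (s≤s z≤n) 2^ℓ≤s² (s≤s z≤n)
             δ 0<2Δ ≡.refl ℕ.≤-refl u nothing (λ _ → z≤n)
             (ℕ.≤-trans (total-≤ bound≤k) (ℕ.≤-trans nk≤ (ℕ.m≤n+m _ _)))) =
    C′ , multi′ , depth , R.trans poly (value≋ (output C)) ,
    large-degree-bound {n = n} {k} ℓ r 1≤Δ (s≤s z≤n) 2≤s s≤2^1+m (s≤s z≤n) (ℕ.<⇒≤ (ℕ.≰⇒> nk≰)) size′

theorem1p8 : ∃ω ℕ λ c →
    ∀ {a ℓ₁ ℓ₂} (F : HeytingField a ℓ₁ ℓ₂) (n k Δ s : ℕ) →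
    1 ≤ n → 1 ≤ k → 1 ≤ Δ → 2 ≤ s →
    (C : Circuit (HeytingField.Carrier F) n) →
    MultiIc k C → size C ≡ s →
    Σ (Circuit (HeytingField.Carrier F) n) λ C′ →
    MultiIc k C′ ×
    ProductDepth Δ C′ ×
    _≋_ F (polynomial F C′) (polynomial F C) ×
    size C′ ≤ s ^[ exponent c Δ n k s ]
theorem1p8 = 16 , depthReduction
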